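{- The isomorphism problem for 4-multipedes with shoes (given a pair of 4-multipedes with shoes as a single 6-sorted structure, decide whether they are isomorphic) is not definable in $C^\omega_{\infty,\omega}$, and therefore not in FP+Card.
   Context: A 2-multipede is a finite 2-sorted structure with sorts "segments" and "feet", a function $S$ from feet to segments such that every segment is the image of exactly two feet, a family of 3-element sets of segments called hyperedges (coded as a totally irreflexive symmetric ternary relation), and a family of 3-element sets of feet called positive triples (similarly coded), such that: if $P$ is a positive triple then $S(P)$ is a hyperedge; for each hyperedge $H$, exactly four of the eight triples of feet mapped by $S$ onto $H$ are positive; and if $P,P'$ are positive with $S(P)=S(P')$ then $|P\triangle P'|$ is even. A 3-multipede is a 2-multipede with a linear ordering $\le$ of the segments. A 4-multipede is a 3-multipede with a third sort "sets" and a binary relation $\varepsilon$ between segments and sets such that every set of segments equals $\{s:s\,\varepsilon\,x\}$ for a unique element $x$ of the sort of sets. A multipede with a shoe is a multipede with a distinguished foot (the shoe) with $S$ of the shoe the $\le$-first segment. $C^\omega_{\infty,\omega}$ is infinitary logic (arbitrary conjunctions and disjunctions) in which each formula uses finitely many variables, extended with counting quantifiers $\exists^{\ge m}$ ("for at least $m$ values"). FP+Card is fixpoint logic with counting (inflationary fixpoints over a two-sorted extension of the structure by the numbers $0,\dots,|A|$ with successor, plus counting terms $(\sharp x)\varphi(x)$); every FP+Card-definable query is $C^\omega_{\infty,\omega}$-definable. -}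

module Defs where

open import Data.Nat using (ℕ; zero; suc; _+_)
open import Data.Nat.Divisibility using (_∣_)
open import Data.Fin using (Fin; zero; suc; _≟_)
open import Data.Bool using (Bool; true; false; if_then_else_; _∧_; _∨_; _xor_)
open import Data.Product using (Σ; _×_; _,_; proj₁; proj₂)
open import Data.Maybe using (Maybe; just; nothing)
open import Data.Empty using (⊥)
open import Relation.Nullary using (¬_)
open import Relation.Nullary.Decidable using (⌊_⌋)
open import Relation.Binary.PropositionalEquality using (_≡_; _≢_)
open import Function.Bundles using (_↔_; Inverse)

count : ∀ {n} → (Fin n → Bool) → ℕ
count {zero}  p = 0
count {suc n} p = (if p zero then 1 else 0) + count {n} (λ i → p (suc i))

sumFin : ∀ {n} → (Fin n → ℕ) → ℕ
sumFin {zero}  f = 0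
sumFin {suc n} f = f zero + sumFin {n} (λ i → f (suc i))

count3 : ∀ {n} → (Fin n → Fin n → Fin n → Bool) → ℕ
count3 p = sumFin (λ a → sumFin (λ b → count (λ c → p a b c)))

_==_ : ∀ {n} → Fin n → Fin n → Bool
a == b = ⌊ a ≟ b ⌋

mem3 : ∀ {n} → Fin n → Fin n → Fin n → Fin n → Bool
mem3 x a b c = (x == a) ∨ (x == b) ∨ (x == c)

-- Totally irreflexive symmetric ternary relations (coding 3-element sets)

IsTripleSystem : ∀ {n} → (Fin n → Fin n → Fin n → Bool) → Set
IsTripleSystem {n} R =
  (∀ a b c → R a b c ≡ true → (a ≢ b) × (b ≢ c) × (a ≢ c))
  × (∀ a b c → R a b c ≡ R b a c)
  × (∀ a b c → R a b c ≡ R a c b)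

record Multipede4 : Set where
  field
    nSeg nFoot nSet : ℕ
    S    : Fin nFoot → Fin nSeg
    H    : Fin nSeg → Fin nSeg → Fin nSeg → Bool
    P    : Fin nFoot → Fin nFoot → Fin nFoot → Bool
    le   : Fin nSeg → Fin nSeg → Bool
    ε    : Fin nSeg → Fin nSet → Bool
    shoe : Fin nFoot
    twoFeet   : ∀ s → count (λ f → S f == s) ≡ 2
    H-triples : IsTripleSystem H
    P-triples : IsTripleSystem P
    pos⇒hyper : ∀ a b c → P a b c ≡ true → H (S a) (S b) (S c) ≡ true
    fourPos   : ∀ x y z → H x y z ≡ true →
                count3 (λ a b c → (S a == x) ∧ (S b == y) ∧ (S c == z) ∧ P a b c) ≡ 4
    evenDiff  : ∀ a b c a' b' c' → P a b c ≡ true → P a' b' c' ≡ true →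
                (∀ s → mem3 s (S a) (S b) (S c) ≡ mem3 s (S a') (S b') (S c')) →
                2 ∣ count (λ f → mem3 f a b c xor mem3 f a' b' c')
    le-refl    : ∀ s → le s s ≡ true
    le-antisym : ∀ s t → le s t ≡ true → le t s ≡ true → s ≡ t
    le-trans   : ∀ s t u → le s t ≡ true → le t u ≡ true → le s u ≡ true
    le-total   : ∀ s t → (le s t ∨ le t s) ≡ true
    sets-ex   : (U : Fin nSeg → Bool) → Σ (Fin nSet) (λ x → ∀ s → ε s x ≡ U s)
    sets-uniq : (U : Fin nSeg → Bool) → ∀ x y →
                (∀ s → ε s x ≡ U s) → (∀ s → ε s y ≡ U s) → x ≡ y
    shoe-first : ∀ s → le (S shoe) s ≡ true

open Multipede4

record Iso (A B : Multipede4) : Set where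
  field
    segs  : Fin (nSeg A) ↔ Fin (nSeg B)
    feet  : Fin (nFoot A) ↔ Fin (nFoot B)
    setsI : Fin (nSet A) ↔ Fin (nSet B)
  σ = Inverse.to segs
  φ = Inverse.to feet
  χ = Inverse.to setsI
  field
    pres-S    : ∀ f → S B (φ f) ≡ σ (S A f)
    pres-H    : ∀ x y z → H B (σ x) (σ y) (σ z) ≡ H A x y z
    pres-P    : ∀ a b c → P B (φ a) (φ b) (φ c) ≡ P A a b c
    pres-le   : ∀ s t → le B (σ s) (σ t) ≡ le A s t
    pres-ε    : ∀ s x → ε B (σ s) (χ x) ≡ ε A s x
    pres-shoe : φ (shoe A) ≡ shoe B

data Side : Set where
  left right : Side

data Kind : Set where
  seg foot set : Kind

Sort : Set
Sort = Side × Kind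

sel : Multipede4 → Multipede4 → Side → Multipede4
sel A B left  = A
sel A B right = B

KCar : Multipede4 → Kind → Set
KCar M seg  = Fin (nSeg M)
KCar M foot = Fin (nFoot M)
KCar M set  = Fin (nSet M)

Carrier : Multipede4 → Multipede4 → Sort → Set
Carrier A B (sd , k) = KCar (sel A B sd) k

Val : Multipede4 → Multipede4 → Set
Val A B = Σ Sort (Carrier A B)

get : ∀ {A B} (sd : Side) (k : Kind) → Val A B → Maybe (KCar (sel A B sd) k)
get left  seg  ((left  , seg)  , e) = just e
get left  foot ((left  , foot) , e) = just e
get left  set  ((left  , set)  , e) = just e
get right seg  ((right , seg)  , e) = just e
get right foot ((right , foot) , e) = just e
get right set  ((right , set)  , e) = just e
get _ _ _ = nothing

holds1 : ∀ {X : Set} → Maybe X → (X → Set) → Set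
holds1 (just x) R = R x
holds1 nothing  R = ⊥

holds2 : ∀ {X Y : Set} → Maybe X → Maybe Y → (X → Y → Set) → Set
holds2 mx my R = holds1 mx (λ x → holds1 my (λ y → R x y))

holds3 : ∀ {X Y Z : Set} → Maybe X → Maybe Y → Maybe Z → (X → Y → Z → Set) → Set
holds3 mx my mz R = holds1 mx (λ x → holds2 my mz (λ y z → R x y z))

data Atom (k : ℕ) : Set where
  eqA   : Fin k → Fin k → Atom k
  SA    : Side → Fin k → Fin k → Atom k            -- S(x) = y, x foot, y segment
  HA    : Side → Fin k → Fin k → Fin k → Atom k
  PA    : Side → Fin k → Fin k → Fin k → Atom k
  leA   : Side → Fin k → Fin k → Atom k
  εA    : Side → Fin k → Fin k → Atom k            -- x segment, y set
  shoeA : Side → Fin k → Atom k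

data Form (k : ℕ) : Set₁ where
  atom : Atom k → Form k
  neg  : Form k → Form k
  ⋀    : (I : Set) → (I → Form k) → Form k
  ⋁    : (I : Set) → (I → Form k) → Form k
  -- ∃^{≥ m} x (of sort s) φ
  ∃≥   : ℕ → Sort → Fin k → Form k → Form k

Assignment : ℕ → Multipede4 → Multipede4 → Set
Assignment k A B = Fin k → Val A B

update : ∀ {k A B} → Assignment k A B → Fin k → Val A B → Assignment k A B
update ρ x v y = if y == x then v else ρ y

semAtom : ∀ {k} (A B : Multipede4) → Atom k → Assignment k A B → Set
semAtom A B (eqA x y) ρ = ρ x ≡ ρ y
semAtom A B (SA sd x y) ρ =
  holds2 (get sd foot (ρ x)) (get sd seg (ρ y)) (λ f s → S (sel A B sd) f ≡ s)
semAtom A B (HA sd x y z) ρ =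
  holds3 (get sd seg (ρ x)) (get sd seg (ρ y)) (get sd seg (ρ z))
         (λ a b c → H (sel A B sd) a b c ≡ true)
semAtom A B (PA sd x y z) ρ =
  holds3 (get sd foot (ρ x)) (get sd foot (ρ y)) (get sd foot (ρ z))
         (λ a b c → P (sel A B sd) a b c ≡ true)
semAtom A B (leA sd x y) ρ =
  holds2 (get sd seg (ρ x)) (get sd seg (ρ y)) (λ a b → le (sel A B sd) a b ≡ true)
semAtom A B (εA sd x y) ρ =
  holds2 (get sd seg (ρ x)) (get sd set (ρ y)) (λ a b → ε (sel A B sd) a b ≡ true)
semAtom A B (shoeA sd x) ρ =
  holds1 (get sd foot (ρ x)) (λ f → f ≡ shoe (sel A B sd))

Sat : ∀ {k} (A B : Multipede4) → Form k → Assignment k A B → Set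
Sat A B (atom a)   ρ = semAtom A B a ρ
Sat A B (neg φ)    ρ = ¬ Sat A B φ ρ
Sat A B (⋀ I φs)   ρ = (i : I) → Sat A B (φs i) ρ
Sat A B (⋁ I φs)   ρ = Σ I (λ i → Sat A B (φs i) ρ)
Sat A B (∃≥ m s x φ) ρ =
  Σ (Fin m → Carrier A B s) (λ v →
     (∀ i j → v i ≡ v j → i ≡ j) ×
     (∀ i → Sat A B φ (update ρ x (s , v i))))

-- φ defines the isomorphism query on pairs of 4-multipedes with shoes
-- (its truth value is required to be independent of the assignment,
-- i.e. it behaves as a sentence)
DefinesIso : ∀ {k} → Form k → Set
DefinesIso {k} φ = ∀ (A B : Multipede4) (ρ : Assignment k A B) →
  (Sat A B φ ρ → Iso A B) × (Iso A B → Sat A B φ ρ)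

module Submission where

-- A Cai–Fürer–Immerman construction.  Take the cubic graph whose vertices
-- (b , v , j) form 2(k + 2) cycles ("rows" (b , v)) of length k + 2, the rows
-- (false , a) and (true , c) being joined by a link between (false , a , c) and
-- (true , c , a).  Its edges, plus one isolated segment for the shoe, are the
-- segments of a multipede: each has two feet, the three edges at a vertex form a
-- hyperedge, and over a vertex with twist w the positive triples are the lifts
-- whose bits sum to w.
--
-- Twisting one vertex gives a non-isomorphic multipede: an isomorphism fixes the
-- rigidly ordered segments, so it flips the feet of some set of edges, which
-- changes the twist at each vertex by the number of flipped edges there and hence
-- the total twist by an even amount.
--
-- Flipping the edges of a path moves a twist from one end of the path to the
-- other.  In the bijective k-pebble game between the pairs (untwisted , untwisted)
-- and (untwisted , twisted), Duplicator answers every move by such a flip, taking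
-- the twist to a row that no pebble touches.  So the pebbled positions stay partial
-- isomorphisms, no C^k formula separates the two pairs, and none defines
-- isomorphism.

open import Defs
open Multipede4
open import Algebra.Bundles using (CommutativeRing)
import Algebra.Properties.CommutativeMonoid.Sum as CommutativeMonoidSum
open import Algebra.Solver.Ring.AlmostCommutativeRing using (fromCommutativeRing)
import Algebra.Solver.Ring.Simple as RingSolver
open import Data.Bool as Bool using (Bool; true; false; not; if_then_else_; _∧_; _∨_; _xor_)
open import Data.Bool.Properties
  using (xor-∧-commutativeRing; ∧-identityʳ; ∧-comm; xor-identityʳ; xor-comm; xor-same; ∨-zeroʳ)
open import Data.Empty using (⊥; ⊥-elim)
open import Data.Fin as Fin
  using (Fin; zero; suc; toℕ; inject₁; fromℕ; _↑ˡ_; _↑ʳ_; splitAt; join; finToFun; funToFin; _≤?_)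
open import Data.Fin.Induction using (<-weakInduction)
open import Data.Fin.Properties as Finₚ
  using (splitAt-↑ˡ; splitAt-↑ʳ; join-splitAt; suc-injective; any?; 2↔Bool; finToFun-funToFin; funToFin-finToFin;
         toℕ-inject₁; ≤̄⇒inject₁<; ≤∧≢⇒<; <⇒≢; ≤fromℕ; +↔⊎; *↔×; pigeonhole)
open import Data.List using (List; []; _∷_)
import Data.List.Membership.DecPropositional as DecMembership
open import Data.List.Membership.Propositional using (_∈_)
open import Data.List.Relation.Unary.Any using (here; there)
open import Data.Maybe as Maybe using (Maybe; just; nothing) renaming (map to mapMaybe)
open import Data.Nat as ℕ using (ℕ; _+_; _^_)
open import Data.Nat.Divisibility using (_∣_; divides)
import Data.Nat.Properties as ℕₚ
open import Data.Product as Product using (Σ; ∃; ∃₂; _×_; _,_; proj₁; proj₂; map₂)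
open import Data.Product.Function.NonDependent.Propositional using (_×-↔_)
open import Data.Product.Properties using (,-injectiveˡ; ,-injectiveʳ; ≡-dec)
open import Data.Sum using (_⊎_; inj₁; inj₂; [_,_]′)
open import Data.Sum.Function.Propositional using (_⊎-↔_)
open import Data.Sum.Properties using (inj₁-injective; inj₂-injective)
open import Function using (_∘_; id; _⇔_; mk⇔; Equivalence; _↔_; Inverse; mk↔ₛ′; Injection)
open import Function.Construct.Identity using (⇔-id; ↔-id)
open import Function.Properties.Inverse using (↔-trans; ↔-sym; Inverse⇒Injection)
open import Relation.Binary.Definitions using (DecidableEquality; tri<; tri≈; tri>)
open import Relation.Binary.PropositionalEquality
open import Relation.Nullary using (¬_; Dec; yes; no)
open import Relation.Nullary.Decidable using (⌊_⌋; ⌊⌋-map′; _×-dec_; ¬?; decidable-stable)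

isYes-true : ∀ {A : Set} (d : Dec A) → A → ⌊ d ⌋ ≡ true
isYes-true (yes _) _ = refl
isYes-true (no ¬a) a = ⊥-elim (¬a a)

isYes-false : ∀ {A : Set} (d : Dec A) → ¬ A → ⌊ d ⌋ ≡ false
isYes-false (yes a) ¬a = ⊥-elim (¬a a)
isYes-false (no _) _ = refl

isYes⇒ : ∀ {A : Set} (d : Dec A) → ⌊ d ⌋ ≡ true → A
isYes⇒ (yes a) _ = a

isYes-cong : ∀ {A B : Set} → A ⇔ B → (a : Dec A) (b : Dec B) → ⌊ a ⌋ ≡ ⌊ b ⌋
isYes-cong A⇔B (yes a) b = sym (isYes-true b (Equivalence.to A⇔B a))
isYes-cong A⇔B (no ¬a) b = sym (isYes-false b (¬a ∘ Equivalence.from A⇔B))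

isYes-× : ∀ {A B : Set} (a : Dec A) (b : Dec B) → ⌊ a ×-dec b ⌋ ≡ ⌊ a ⌋ ∧ ⌊ b ⌋
isYes-× (yes _) (yes _) = refl
isYes-× (yes _) (no _) = refl
isYes-× (no _) _ = refl

==-refl : ∀ {n} (i : Fin n) → (i == i) ≡ true
==-refl i = isYes-true (i Fin.≟ i) refl

≢⇒==-false : ∀ {n} {i j : Fin n} → i ≢ j → (i == j) ≡ false
≢⇒==-false {i = i} {j} = isYes-false (i Fin.≟ j)

==-sym : ∀ {n} (i j : Fin n) → (i == j) ≡ (j == i)
==-sym i j = isYes-cong (mk⇔ sym sym) (i Fin.≟ j) (j Fin.≟ i)

==-suc : ∀ {n} (i j : Fin n) → (suc i == suc j) ≡ (i == j)
==-suc i j = ⌊⌋-map′ (cong suc) suc-injective (i Fin.≟ j)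

==-exclusive : ∀ {n} (x : Fin n) {a b} → a ≢ b → (x == a) ∧ (x == b) ≡ false
==-exclusive x {a} {b} a≢b with x Fin.≟ a | x Fin.≟ b
... | yes refl | yes refl = ⊥-elim (a≢b refl)
... | yes _ | no _ = refl
... | no _ | _ = refl

-- Coefficients are normalised in Bool itself, so the solver also knows x xor x = false.
open RingSolver (fromCommutativeRing xor-∧-commutativeRing) Bool._≟_ using (solve; _:+_; _:*_; _:=_)

xor-exchange : ∀ u₀ u₁ v₀ v₁ → u₀ xor u₁ ≡ v₀ xor v₁ → u₀ xor v₀ ≡ u₁ xor v₁
xor-exchange u₀ u₁ v₀ v₁ eq = begin
  u₀ xor v₀                 ≡⟨ solve 3 (λ u₀ u₁ v₀ → u₀ :+ v₀ := (u₀ :+ u₁) :+ (u₁ :+ v₀)) refl u₀ u₁ v₀ ⟩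
  (u₀ xor u₁) xor (u₁ xor v₀) ≡⟨ cong (_xor (u₁ xor v₀)) eq ⟩
  (v₀ xor v₁) xor (u₁ xor v₀) ≡⟨ solve 3 (λ u₁ v₀ v₁ → (v₀ :+ v₁) :+ (u₁ :+ v₀) := u₁ :+ v₁) refl u₁ v₀ v₁ ⟩
  u₁ xor v₁                 ∎
  where open ≡-Reasoning

xor-cancel-⇔ : ∀ u c w → (u xor c ≡ c xor w) ⇔ (u ≡ w)
xor-cancel-⇔ u c w = mk⇔ to (λ u≡w → trans (cong (_xor c) u≡w) (solve 2 (λ w c → w :+ c := c :+ w) refl w c))
  where
  to : u xor c ≡ c xor w → u ≡ w
  to eq = begin
    u                 ≡⟨ solve 2 (λ u c → u := (u :+ c) :+ c) refl u c ⟩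
    (u xor c) xor c   ≡⟨ cong (_xor c) eq ⟩
    (c xor w) xor c   ≡⟨ solve 2 (λ c w → (c :+ w) :+ c := w) refl c w ⟩
    w                 ∎
    where open ≡-Reasoning

∨-exclusive : ∀ x y z → x ∧ y ≡ false → y ∧ z ≡ false → x ∧ z ≡ false → x ∨ y ∨ z ≡ x xor (y xor z)
∨-exclusive true true _ () _ _
∨-exclusive true false true _ _ ()
∨-exclusive true false false _ _ _ = refl
∨-exclusive false true true _ () _
∨-exclusive false true false _ _ _ = refl
∨-exclusive false false z _ _ _ = refl

open CommutativeMonoidSum (CommutativeRing.+-commutativeMonoid xor-∧-commutativeRing)
  using () renaming (sum to parity; sum-cong-≗ to parity-cong; ∑-distrib-+ to parity-xor;
                     ∑-comm to parity-comm; sum-init-last to parity-init-last;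
                     sum-replicate-zero to parity-false)

parity-indicator : ∀ {n} (x : Fin n) (b : Bool) → parity (λ i → (i == x) ∧ b) ≡ b
parity-indicator {ℕ.suc n} zero b = trans (cong (b xor_) (parity-false n)) (xor-identityʳ b)
parity-indicator (suc x) b = trans (parity-cong (λ i → cong (_∧ b) (==-suc i x))) (parity-indicator x b)

-- The summand of count; Bool.toℕ b would not be definitionally equal to it.
indicator : Bool → ℕ
indicator b = if b then 1 else 0

count-cong : ∀ {n} {p q : Fin n → Bool} → (∀ i → p i ≡ q i) → count p ≡ count q
count-cong {ℕ.zero} _ = refl
count-cong {ℕ.suc n} p≗q = cong₂ _+_ (cong indicator (p≗q zero)) (count-cong (p≗q ∘ suc))

sumFin-cong : ∀ {n} {f g : Fin n → ℕ} → (∀ i → f i ≡ g i) → sumFin f ≡ sumFin g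
sumFin-cong {ℕ.zero} _ = refl
sumFin-cong {ℕ.suc n} f≗g = cong₂ _+_ (f≗g zero) (sumFin-cong (f≗g ∘ suc))

count-false : ∀ n → count {n} (λ _ → false) ≡ 0
count-false ℕ.zero = refl
count-false (ℕ.suc n) = count-false n

sumFin-zero : ∀ n → sumFin {n} (λ _ → 0) ≡ 0
sumFin-zero ℕ.zero = refl
sumFin-zero (ℕ.suc n) = sumFin-zero n

count-++ : ∀ m {n} (p : Fin (m + n) → Bool) →
           count p ≡ count (λ i → p (i ↑ˡ n)) + count (λ j → p (m ↑ʳ j))
count-++ ℕ.zero p = refl
count-++ (ℕ.suc m) p =
  trans (cong (indicator (p zero) +_) (count-++ m (p ∘ suc))) (sym (ℕₚ.+-assoc (indicator (p zero)) _ _))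

sumFin-++ : ∀ m {n} (f : Fin (m + n) → ℕ) →
            sumFin f ≡ sumFin (λ i → f (i ↑ˡ n)) + sumFin (λ j → f (m ↑ʳ j))
sumFin-++ ℕ.zero f = refl
sumFin-++ (ℕ.suc m) f = trans (cong (f zero +_) (sumFin-++ m (f ∘ suc))) (sym (ℕₚ.+-assoc (f zero) _ _))

count-indicator : ∀ {n} (x : Fin n) (q : Fin n → Bool) → count (λ i → (i == x) ∧ q i) ≡ indicator (q x)
count-indicator {ℕ.suc n} zero q = trans (cong (indicator (q zero) +_) (count-false n)) (ℕₚ.+-identityʳ _)
count-indicator (suc x) q = trans (count-cong (λ i → cong (_∧ q (suc i)) (==-suc i x))) (count-indicator x (q ∘ suc))

sumFin-indicator : ∀ {n} (x : Fin n) (f : Fin n → ℕ) → sumFin (λ i → if i == x then f i else 0) ≡ f x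
sumFin-indicator {ℕ.suc n} zero f = trans (cong (f zero +_) (sumFin-zero n)) (ℕₚ.+-identityʳ _)
sumFin-indicator (suc x) f =
  trans (sumFin-cong (λ i → cong (λ b → if b then f (suc i) else 0) (==-suc i x))) (sumFin-indicator x (f ∘ suc))

count-guard : ∀ {n} (b : Bool) (q : Fin n → Bool) → count (λ i → b ∧ q i) ≡ (if b then count q else 0)
count-guard true q = refl
count-guard {n} false q = count-false n

sumFin-guard : ∀ {n} (b : Bool) (f : Fin n → ℕ) → sumFin (λ i → if b then f i else 0) ≡ (if b then sumFin f else 0)
sumFin-guard true f = refl
sumFin-guard {n} false f = sumFin-zero n

sumBool : (Bool → ℕ) → ℕ
sumBool f = f false + f true

sumBool-cong : ∀ {f g : Bool → ℕ} → (∀ b → f b ≡ g b) → sumBool f ≡ sumBool g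
sumBool-cong f≗g = cong₂ _+_ (f≗g false) (f≗g true)

n∣n+n : ∀ n → 2 ∣ n + n
n∣n+n n = divides n (trans (cong (n +_) (sym (ℕₚ.+-identityʳ n))) (ℕₚ.*-comm 2 n))

funToFin-cong : ∀ {m n} {f g : Fin m → Fin n} → (∀ i → f i ≡ g i) → funToFin f ≡ funToFin g
funToFin-cong {ℕ.zero} _ = refl
funToFin-cong {ℕ.suc m} f≗g = cong₂ Fin.combine (f≗g zero) (funToFin-cong (f≗g ∘ suc))

strictlyMonotone⇒inflationary : ∀ {m} (f : Fin m → Fin m) → (∀ {i j} → i Fin.< j → f i Fin.< f j) →
                                ∀ i → i Fin.≤ f i
strictlyMonotone⇒inflationary {ℕ.suc m} f mono = <-weakInduction (λ i → i Fin.≤ f i) ℕ.z≤n step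
  where
  step : ∀ i → inject₁ i Fin.≤ f (inject₁ i) → suc i Fin.≤ f (suc i)
  step i ih = ℕₚ.≤-<-trans (subst (ℕ._≤ toℕ (f (inject₁ i))) (toℕ-inject₁ i) ih) (mono (≤̄⇒inject₁< Finₚ.≤-refl))

order-automorphism-id : ∀ {m} (σ : Fin m ↔ Fin m) →
  (∀ s t → ⌊ Inverse.to σ s ≤? Inverse.to σ t ⌋ ≡ ⌊ s ≤? t ⌋) → ∀ s → Inverse.to σ s ≡ s
order-automorphism-id σ preserves s = Finₚ.≤-antisym σs≤s s≤σs
  where
  open Inverse σ using (to; from; strictlyInverseˡ; strictlyInverseʳ)
  monotone : ∀ {f g : Fin _ → Fin _} → (∀ x → g (f x) ≡ x) → (∀ s t → ⌊ f s ≤? f t ⌋ ≡ ⌊ s ≤? t ⌋) →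
             ∀ {i j} → i Fin.< j → f i Fin.< f j
  monotone {f} {g} gf f-preserves {i} {j} i<j =
    ≤∧≢⇒< (isYes⇒ (f i ≤? f j) (trans (f-preserves i j) (isYes-true (i ≤? j) (ℕₚ.<⇒≤ i<j))))
          (λ eq → <⇒≢ i<j (trans (sym (gf i)) (trans (cong g eq) (gf j))))
  from-preserves : ∀ s t → ⌊ from s ≤? from t ⌋ ≡ ⌊ s ≤? t ⌋
  from-preserves s t = trans (sym (preserves (from s) (from t)))
                             (cong₂ (λ a b → ⌊ a ≤? b ⌋) (strictlyInverseˡ s) (strictlyInverseˡ t))
  s≤σs : s Fin.≤ to s
  s≤σs = strictlyMonotone⇒inflationary to (monotone {to} {from} strictlyInverseʳ preserves) s
  σs≤s : to s Fin.≤ s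
  σs≤s = subst (to s Fin.≤_) (strictlyInverseʳ s)
               (strictlyMonotone⇒inflationary from (monotone {from} {to} strictlyInverseˡ from-preserves) (to s))

∃-notInImage : ∀ {L m} → L ℕ.< m → (f : Fin L → Fin m) → ∃ λ w → ∀ i → f i ≢ w
∃-notInImage L<m f with any? (λ w → ¬? (any? (λ i → f i Fin.≟ w)))
... | yes (w , w-missed) = w , λ i eq → w-missed (i , eq)
... | no nothing-missed = ⊥-elim (collision (pigeonhole L<m (proj₁ ∘ hit)))
  where
  hit : ∀ w → ∃ λ i → f i ≡ w
  hit w = decidable-stable (any? (λ i → f i Fin.≟ w)) (λ missed → nothing-missed (w , missed))
  collision : ∃₂ (λ v w → v Fin.< w × proj₁ (hit v) ≡ proj₁ (hit w)) → ⊥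
  collision (v , w , v<w , same-preimage) =
    <⇒≢ v<w (trans (sym (proj₂ (hit v))) (trans (cong f same-preimage) (proj₂ (hit w))))

prev : ∀ {n} → Fin (ℕ.suc n) → Fin (ℕ.suc n)
prev zero = fromℕ _
prev (suc j) = inject₁ j

prev-≢ : ∀ {n} (j : Fin (ℕ.suc (ℕ.suc n))) → prev j ≢ j
prev-≢ zero ()
prev-≢ (suc j) eq = ℕₚ.1+n≢n (sym (trans (sym (toℕ-inject₁ j)) (cong toℕ eq)))

parity-prev : ∀ {n} (g : Fin (ℕ.suc n) → Bool) → parity (g ∘ prev) ≡ parity g
parity-prev {n} g = trans (xor-comm (g (fromℕ n)) _) (sym (parity-init-last g))

≤?-zero : ∀ {n} (r : Fin (ℕ.suc n)) → ⌊ r ≤? zero {n} ⌋ ≡ (r == zero)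
≤?-zero zero = refl
≤?-zero (suc r) = refl

≤?-suc : ∀ {n} (r : Fin (ℕ.suc n)) (j : Fin n) → ⌊ r ≤? inject₁ j ⌋ xor ⌊ r ≤? suc j ⌋ ≡ (r == suc j)
≤?-suc r j with Finₚ.<-cmp r (suc j)
... | tri< r<1+j r≢1+j _
  rewrite isYes-true (r ≤? inject₁ j) (subst (toℕ r ℕ.≤_) (sym (toℕ-inject₁ j)) (ℕₚ.≤-pred r<1+j))
        | isYes-true (r ≤? suc j) (ℕₚ.<⇒≤ r<1+j) | ≢⇒==-false r≢1+j = refl
... | tri≈ _ refl _
  rewrite isYes-false (suc j ≤? inject₁ j) (ℕₚ.<-irrefl (sym (toℕ-inject₁ j)))
        | isYes-true (suc j ≤? suc j) Finₚ.≤-refl | ==-refl (suc j) = refl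
... | tri> _ r≢1+j 1+j<r
  rewrite isYes-false (r ≤? inject₁ j) (λ le → ℕₚ.<⇒≱ 1+j<r (ℕₚ.m≤n⇒m≤1+n (subst (toℕ r ℕ.≤_) (toℕ-inject₁ j) le)))
        | isYes-false (r ≤? suc j) (ℕₚ.<⇒≱ 1+j<r) | ≢⇒==-false r≢1+j = refl

≤?-prev : ∀ {n} (r j : Fin (ℕ.suc n)) → ⌊ r ≤? prev j ⌋ xor ⌊ r ≤? j ⌋ ≡ (j == r) xor (j == zero)
≤?-prev {n} r zero rewrite isYes-true (r ≤? fromℕ n) (≤fromℕ r) | ≤?-zero r | ==-sym zero r = xor-comm true (r == zero)
≤?-prev r (suc j) = trans (≤?-suc r j) (trans (==-sym r (suc j)) (sym (xor-identityʳ (suc j == r))))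

Triple : Set → Set
Triple A = A × A × A

map₃ : ∀ {A B : Set} → (A → B) → Triple A → Triple B
map₃ f (a , b , c) = f a , f b , f c

All₃ : ∀ {A : Set} → (A → Set) → Triple A → Set
All₃ P (a , b , c) = P a × P b × P c

Distinct : ∀ {A : Set} → Triple A → Set
Distinct (a , b , c) = a ≢ b × b ≢ c × a ≢ c

Distinct-map₃ : ∀ {A B : Set} {f : A → B} → (∀ {x y} → f x ≡ f y → x ≡ y) → ∀ {t} → Distinct t → Distinct (map₃ f t)
Distinct-map₃ f-injective (d₁ , d₂ , d₃) = d₁ ∘ f-injective , d₂ ∘ f-injective , d₃ ∘ f-injective

Distinct-map₃⁻ : ∀ {A B : Set} (f : A → B) {t} → Distinct (map₃ f t) → Distinct t
Distinct-map₃⁻ f (d₁ , d₂ , d₃) = d₁ ∘ cong f , d₂ ∘ cong f , d₃ ∘ cong f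

sum₃ : ∀ {A : Set} → (A → Bool) → Triple A → Bool
sum₃ g (a , b , c) = g a xor (g b xor g c)

sum₃-xor : ∀ {A : Set} (g h : A → Bool) t → sum₃ (λ a → g a xor h a) t ≡ sum₃ g t xor sum₃ h t
sum₃-xor g h (a , b , c) =
  solve 6 (λ x x′ y y′ z z′ → (x :+ x′) :+ ((y :+ y′) :+ (z :+ z′)) := (x :+ (y :+ z)) :+ (x′ :+ (y′ :+ z′)))
        refl (g a) (h a) (g b) (h b) (g c) (h c)

_∈₃_ : ∀ {A : Set} → A → Triple A → Set
x ∈₃ (a , b , c) = x ≡ a ⊎ x ≡ b ⊎ x ≡ c

∈₃-map₃⁻ : ∀ {A B : Set} {f : A → B} → (∀ {x y} → f x ≡ f y → x ≡ y) → ∀ {x t} → f x ∈₃ map₃ f t → x ∈₃ t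
∈₃-map₃⁻ f-injective (inj₁ eq) = inj₁ (f-injective eq)
∈₃-map₃⁻ f-injective (inj₂ (inj₁ eq)) = inj₂ (inj₁ (f-injective eq))
∈₃-map₃⁻ f-injective (inj₂ (inj₂ eq)) = inj₂ (inj₂ (f-injective eq))

mem3-sum₃ : ∀ {n} (x : Fin n) {a b c} → Distinct (a , b , c) → mem3 x a b c ≡ sum₃ (x ==_) (a , b , c)
mem3-sum₃ x (a≢b , b≢c , a≢c) =
  ∨-exclusive (x == _) (x == _) (x == _) (==-exclusive x a≢b) (==-exclusive x b≢c) (==-exclusive x a≢c)

orderings : ∀ {A : Set} → Triple A → List (Triple A)
orderings (p , q , r) = (p , q , r) ∷ (p , r , q) ∷ (q , p , r) ∷ (q , r , p) ∷ (r , p , q) ∷ (r , q , p) ∷ []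

pattern ∈pqr = here refl
pattern ∈prq = there (here refl)
pattern ∈qpr = there (there (here refl))
pattern ∈qrp = there (there (there (here refl)))
pattern ∈rpq = there (there (there (there (here refl))))
pattern ∈rqp = there (there (there (there (there (here refl)))))

module _ {A : Set} where

  orderings-sym : ∀ {s t : Triple A} → s ∈ orderings t → t ∈ orderings s
  orderings-sym ∈pqr = ∈pqr
  orderings-sym ∈prq = ∈prq
  orderings-sym ∈qpr = ∈qpr
  orderings-sym ∈qrp = ∈rpq
  orderings-sym ∈rpq = ∈qrp
  orderings-sym ∈rqp = ∈rqp

  orderings-swap₁₂ : ∀ {x y z : A} {t} → (x , y , z) ∈ orderings t → (y , x , z) ∈ orderings t
  orderings-swap₁₂ ∈pqr = ∈qpr
  orderings-swap₁₂ ∈prq = ∈rpq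
  orderings-swap₁₂ ∈qpr = ∈pqr
  orderings-swap₁₂ ∈qrp = ∈rqp
  orderings-swap₁₂ ∈rpq = ∈prq
  orderings-swap₁₂ ∈rqp = ∈qrp

  orderings-swap₂₃ : ∀ {x y z : A} {t} → (x , y , z) ∈ orderings t → (x , z , y) ∈ orderings t
  orderings-swap₂₃ ∈pqr = ∈prq
  orderings-swap₂₃ ∈prq = ∈pqr
  orderings-swap₂₃ ∈qpr = ∈qrp
  orderings-swap₂₃ ∈qrp = ∈qpr
  orderings-swap₂₃ ∈rpq = ∈rqp
  orderings-swap₂₃ ∈rqp = ∈rpq

  All₃-orderings : ∀ {P : A → Set} {s t} → s ∈ orderings t → All₃ P s → All₃ P t
  All₃-orderings ∈pqr (p , q , r) = p , q , r
  All₃-orderings ∈prq (p , r , q) = p , q , r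
  All₃-orderings ∈qpr (q , p , r) = p , q , r
  All₃-orderings ∈qrp (q , r , p) = p , q , r
  All₃-orderings ∈rpq (r , p , q) = p , q , r
  All₃-orderings ∈rqp (r , q , p) = p , q , r

  orderings-distinct : ∀ {s t : Triple A} → Distinct t → s ∈ orderings t → Distinct s
  orderings-distinct (p≢q , q≢r , p≢r) ∈pqr = p≢q , q≢r , p≢r
  orderings-distinct (p≢q , q≢r , p≢r) ∈prq = p≢r , q≢r ∘ sym , p≢q
  orderings-distinct (p≢q , q≢r , p≢r) ∈qpr = p≢q ∘ sym , p≢r , q≢r
  orderings-distinct (p≢q , q≢r , p≢r) ∈qrp = q≢r , p≢r ∘ sym , p≢q ∘ sym
  orderings-distinct (p≢q , q≢r , p≢r) ∈rpq = p≢r ∘ sym , p≢q , q≢r ∘ sym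
  orderings-distinct (p≢q , q≢r , p≢r) ∈rqp = q≢r ∘ sym , p≢q ∘ sym , p≢r ∘ sym

  orderings-sum₃ : ∀ (g : A → Bool) {s t} → s ∈ orderings t → sum₃ g s ≡ sum₃ g t
  orderings-sum₃ g ∈pqr = refl
  orderings-sum₃ g {t = p , q , r} ∈prq =
    solve 3 (λ p q r → p :+ (r :+ q) := p :+ (q :+ r)) refl (g p) (g q) (g r)
  orderings-sum₃ g {t = p , q , r} ∈qpr =
    solve 3 (λ p q r → q :+ (p :+ r) := p :+ (q :+ r)) refl (g p) (g q) (g r)
  orderings-sum₃ g {t = p , q , r} ∈qrp =
    solve 3 (λ p q r → q :+ (r :+ p) := p :+ (q :+ r)) refl (g p) (g q) (g r)
  orderings-sum₃ g {t = p , q , r} ∈rpq =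
    solve 3 (λ p q r → r :+ (p :+ q) := p :+ (q :+ r)) refl (g p) (g q) (g r)
  orderings-sum₃ g {t = p , q , r} ∈rqp =
    solve 3 (λ p q r → r :+ (q :+ p) := p :+ (q :+ r)) refl (g p) (g q) (g r)

-- Counting logic and bijective pebble games

update-pointwise : ∀ {k} {X Y : Set} (R : X → Y → Set) {ρ : Fin k → X} {ρ′ : Fin k → Y} x {v v′} →
                   R v v′ → (∀ y → R (ρ y) (ρ′ y)) → ∀ y → R (if y == x then v else ρ y) (if y == x then v′ else ρ′ y)
update-pointwise R x Rvv′ Rρρ′ y with y == x
... | true = Rvv′
... | false = Rρρ′ y

update-all : ∀ {k} {X : Set} (P : X → Set) {ρ : Fin k → X} x {v} →
             P v → (∀ y → P (ρ y)) → ∀ y → P (if y == x then v else ρ y)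
update-all P x Pv Pρ y with y == x
... | true = Pv
... | false = Pρ y

module BijectivePebbleGame
  {A B A′ B′ : Multipede4} {k : ℕ}
  (Good : Assignment k A B → Assignment k A′ B′ → Set)
  (atoms-agree : ∀ {ρ ρ′} → Good ρ ρ′ → ∀ a → semAtom A B a ρ ⇔ semAtom A′ B′ a ρ′)
  (respond : ∀ {ρ ρ′} → Good ρ ρ′ → ∀ x s → Σ (Carrier A B s ↔ Carrier A′ B′ s) λ β →
             ∀ c → Good (update ρ x (s , c)) (update ρ′ x (s , Inverse.to β c)))
  where

  Sat-agree : ∀ φ {ρ ρ′} → Good ρ ρ′ → Sat A B φ ρ ⇔ Sat A′ B′ φ ρ′
  Sat-agree (atom a) good = atoms-agree good a
  Sat-agree (neg φ) good = mk⇔ (λ ¬sat sat′ → ¬sat (from sat′)) (λ ¬sat′ sat → ¬sat′ (to sat))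
    where open Equivalence (Sat-agree φ good)
  Sat-agree (⋀ I φs) good =
    mk⇔ (λ sat i → Equivalence.to (Sat-agree (φs i) good) (sat i))
        (λ sat i → Equivalence.from (Sat-agree (φs i) good) (sat i))
  Sat-agree (⋁ I φs) good =
    mk⇔ (λ (i , sat) → i , Equivalence.to (Sat-agree (φs i) good) sat)
        (λ (i , sat) → i , Equivalence.from (Sat-agree (φs i) good) sat)
  Sat-agree (∃≥ m s x φ) {ρ} {ρ′} good = mk⇔ forth back
    where
    β : Carrier A B s ↔ Carrier A′ B′ s
    β = proj₁ (respond good x s)
    open Inverse β using (to; from; strictlyInverseˡ)

    good-to : ∀ c → Good (update ρ x (s , c)) (update ρ′ x (s , to c))
    good-to = proj₂ (respond good x s)

    good-from : ∀ c → Good (update ρ x (s , from c)) (update ρ′ x (s , c))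
    good-from c = subst (λ c′ → Good (update ρ x (s , from c)) (update ρ′ x (s , c′)))
                        (strictlyInverseˡ c) (good-to (from c))

    forth : Sat A B (∃≥ m s x φ) ρ → Sat A′ B′ (∃≥ m s x φ) ρ′
    forth (v , v-injective , v-sat) =
      to ∘ v ,
      (λ i j eq → v-injective i j (Injection.injective (Inverse⇒Injection β) eq)) ,
      (λ i → Equivalence.to (Sat-agree φ (good-to (v i))) (v-sat i))

    back : Sat A′ B′ (∃≥ m s x φ) ρ′ → Sat A B (∃≥ m s x φ) ρ
    back (v , v-injective , v-sat) =
      from ∘ v ,
      (λ i j eq → v-injective i j (trans (sym (strictlyInverseˡ (v i))) (trans (cong to eq) (strictlyInverseˡ (v j))))) ,
      (λ i → Equivalence.from (Sat-agree φ (good-from (v i))) (v-sat i))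

holds1-map : ∀ {X Y : Set} (f : X → Y) (mx : Maybe X) {R : X → Set} {R′ : Y → Set} →
             (∀ {a} → mx ≡ just a → R a ⇔ R′ (f a)) → holds1 mx R ⇔ holds1 (mapMaybe f mx) R′
holds1-map f (just x) R⇔R′ = R⇔R′ refl
holds1-map f nothing R⇔R′ = ⇔-id _

module SortwiseMap {A B A′ B′ : Multipede4} (h : ∀ s → Carrier A B s → Carrier A′ B′ s) where

  mapVal : Val A B → Val A′ B′
  mapVal (s , c) = s , h s c

  get-mapVal : ∀ sd κ v → get sd κ (mapVal v) ≡ mapMaybe (h (sd , κ)) (get sd κ v)
  get-mapVal left  seg  ((left  , seg ) , _) = refl
  get-mapVal left  seg  ((left  , foot) , _) = refl
  get-mapVal left  seg  ((left  , set ) , _) = refl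
  get-mapVal left  seg  ((right , _   ) , _) = refl
  get-mapVal left  foot ((left  , seg ) , _) = refl
  get-mapVal left  foot ((left  , foot) , _) = refl
  get-mapVal left  foot ((left  , set ) , _) = refl
  get-mapVal left  foot ((right , _   ) , _) = refl
  get-mapVal left  set  ((left  , seg ) , _) = refl
  get-mapVal left  set  ((left  , foot) , _) = refl
  get-mapVal left  set  ((left  , set ) , _) = refl
  get-mapVal left  set  ((right , _   ) , _) = refl
  get-mapVal right seg  ((left  , _   ) , _) = refl
  get-mapVal right seg  ((right , seg ) , _) = refl
  get-mapVal right seg  ((right , foot) , _) = refl
  get-mapVal right seg  ((right , set ) , _) = refl
  get-mapVal right foot ((left  , _   ) , _) = refl
  get-mapVal right foot ((right , seg ) , _) = refl
  get-mapVal right foot ((right , foot) , _) = refl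
  get-mapVal right foot ((right , set ) , _) = refl
  get-mapVal right set  ((left  , _   ) , _) = refl
  get-mapVal right set  ((right , seg ) , _) = refl
  get-mapVal right set  ((right , foot) , _) = refl
  get-mapVal right set  ((right , set ) , _) = refl

  record EmbeddingAt {k : ℕ} (ρ : Assignment k A B) : Set where
    field
      injective : ∀ s {c c′} → h s c ≡ h s c′ → c ≡ c′
      S-commutes : ∀ sd f → S (sel A′ B′ sd) (h (sd , foot) f) ≡ h (sd , seg) (S (sel A B sd) f)
      H-preserved : ∀ sd x y z →
        H (sel A′ B′ sd) (h (sd , seg) x) (h (sd , seg) y) (h (sd , seg) z) ≡ H (sel A B sd) x y z
      P-preserved : ∀ sd {x y z a b c} →
        get sd foot (ρ x) ≡ just a → get sd foot (ρ y) ≡ just b → get sd foot (ρ z) ≡ just c →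
        P (sel A′ B′ sd) (h (sd , foot) a) (h (sd , foot) b) (h (sd , foot) c) ≡ P (sel A B sd) a b c
      le-preserved : ∀ sd x y → le (sel A′ B′ sd) (h (sd , seg) x) (h (sd , seg) y) ≡ le (sel A B sd) x y
      ε-preserved : ∀ sd x X → ε (sel A′ B′ sd) (h (sd , seg) x) (h (sd , set) X) ≡ ε (sel A B sd) x X
      shoe-preserved : ∀ sd → h (sd , foot) (shoe (sel A B sd)) ≡ shoe (sel A′ B′ sd)

  module _ {k : ℕ} {ρ : Assignment k A B} {ρ′ : Assignment k A′ B′} (emb : EmbeddingAt ρ)
           (ρ′≗ : ∀ y → ρ′ y ≡ mapVal (ρ y)) where
    open EmbeddingAt emb

    true-cong : ∀ {b b′ : Bool} → b′ ≡ b → (b ≡ true) ⇔ (b′ ≡ true)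
    true-cong refl = ⇔-id _

    atoms-agree : ∀ a → semAtom A B a ρ ⇔ semAtom A′ B′ a ρ′
    atoms-agree (eqA x y) rewrite ρ′≗ x | ρ′≗ y = mk⇔ (cong mapVal) mapVal-injective
      where
      mapVal-injective : ∀ {v w} → mapVal v ≡ mapVal w → v ≡ w
      mapVal-injective {s , c} {s′ , c′} eq with ,-injectiveˡ eq
      ... | refl = cong (s ,_) (injective s (,-injectiveʳ-same eq))
        where
        ,-injectiveʳ-same : ∀ {u w : Carrier A′ B′ s} → _≡_ {A = Val A′ B′} (s , u) (s , w) → u ≡ w
        ,-injectiveʳ-same refl = refl
    atoms-agree (SA sd x y)
      rewrite ρ′≗ x | ρ′≗ y | get-mapVal sd foot (ρ x) | get-mapVal sd seg (ρ y) =
      holds1-map _ (get sd foot (ρ x)) λ {f} _ → holds1-map _ (get sd seg (ρ y)) λ _ →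
        mk⇔ (λ eq → trans (S-commutes sd f) (cong (h (sd , seg)) eq))
            (λ eq → injective (sd , seg) (trans (sym (S-commutes sd f)) eq))
    atoms-agree (HA sd x y z)
      rewrite ρ′≗ x | ρ′≗ y | ρ′≗ z
            | get-mapVal sd seg (ρ x) | get-mapVal sd seg (ρ y) | get-mapVal sd seg (ρ z) =
      holds1-map _ (get sd seg (ρ x)) λ _ → holds1-map _ (get sd seg (ρ y)) λ _ →
        holds1-map _ (get sd seg (ρ z)) λ _ → true-cong (H-preserved sd _ _ _)
    atoms-agree (PA sd x y z)
      rewrite ρ′≗ x | ρ′≗ y | ρ′≗ z
            | get-mapVal sd foot (ρ x) | get-mapVal sd foot (ρ y) | get-mapVal sd foot (ρ z) =
      holds1-map _ (get sd foot (ρ x)) λ ja → holds1-map _ (get sd foot (ρ y)) λ jb →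
        holds1-map _ (get sd foot (ρ z)) λ jc → true-cong (P-preserved sd ja jb jc)
    atoms-agree (leA sd x y)
      rewrite ρ′≗ x | ρ′≗ y | get-mapVal sd seg (ρ x) | get-mapVal sd seg (ρ y) =
      holds1-map _ (get sd seg (ρ x)) λ _ → holds1-map _ (get sd seg (ρ y)) λ _ →
        true-cong (le-preserved sd _ _)
    atoms-agree (εA sd x y)
      rewrite ρ′≗ x | ρ′≗ y | get-mapVal sd seg (ρ x) | get-mapVal sd set (ρ y) =
      holds1-map _ (get sd seg (ρ x)) λ _ → holds1-map _ (get sd set (ρ y)) λ _ →
        true-cong (ε-preserved sd _ _)
    atoms-agree (shoeA sd x) rewrite ρ′≗ x | get-mapVal sd foot (ρ x) =
      holds1-map _ (get sd foot (ρ x)) λ {f} _ →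
        mk⇔ (λ eq → trans (cong (h (sd , foot)) eq) (shoe-preserved sd))
            (λ eq → injective (sd , foot) (trans eq (sym (shoe-preserved sd))))

Iso-refl : ∀ A → Iso A A
Iso-refl A = record
  { segs = ↔-id _ ; feet = ↔-id _ ; setsI = ↔-id _
  ; pres-S = λ _ → refl ; pres-H = λ _ _ _ → refl ; pres-P = λ _ _ _ → refl
  ; pres-le = λ _ _ → refl ; pres-ε = λ _ _ → refl ; pres-shoe = refl
  }

-- Multipedes over a system of triples

module CFI (m N : ℕ) (triple : Fin N → Triple (Fin (ℕ.suc m)))
           (triple-distinct : ∀ i → Distinct (triple i))
           (triple-determines : ∀ i j → All₃ (_∈₃ triple j) (triple i) → i ≡ j)
  where

  M : ℕ
  M = ℕ.suc m

  Seg : Set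
  Seg = Fin M

  Foot : Set
  Foot = Fin (M + M)

  footAt : Seg → Bool → Foot
  footAt s false = s ↑ˡ M
  footAt s true = M ↑ʳ s

  segOf : Foot → Seg
  segOf f = [ id , id ]′ (splitAt M f)

  bitOf : Foot → Bool
  bitOf f = [ (λ _ → false) , (λ _ → true) ]′ (splitAt M f)

  segOf-footAt : ∀ s b → segOf (footAt s b) ≡ s
  segOf-footAt s false rewrite splitAt-↑ˡ M s M = refl
  segOf-footAt s true rewrite splitAt-↑ʳ M M s = refl

  bitOf-footAt : ∀ s b → bitOf (footAt s b) ≡ b
  bitOf-footAt s false rewrite splitAt-↑ˡ M s M = refl
  bitOf-footAt s true rewrite splitAt-↑ʳ M M s = refl

  foot-η : ∀ f → footAt (segOf f) (bitOf f) ≡ f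
  foot-η f = trans (foot-join (splitAt M f)) (join-splitAt M M f)
    where
    foot-join : ∀ w → footAt ([ id , id ]′ w) ([ (λ _ → false) , (λ _ → true) ]′ w) ≡ join M M w
    foot-join (inj₁ _) = refl
    foot-join (inj₂ _) = refl

  footAt-== : ∀ s b t b′ → (footAt s b == footAt t b′) ≡ (s == t) ∧ ⌊ b Bool.≟ b′ ⌋
  footAt-== s b t b′ =
    trans (isYes-cong (mk⇔ to from) _ ((s Fin.≟ t) ×-dec (b Bool.≟ b′))) (isYes-× (s Fin.≟ t) (b Bool.≟ b′))
    where
    to : footAt s b ≡ footAt t b′ → s ≡ t × b ≡ b′
    to eq = trans (sym (segOf-footAt s b)) (trans (cong segOf eq) (segOf-footAt t b′)) ,
            trans (sym (bitOf-footAt s b)) (trans (cong bitOf eq) (bitOf-footAt t b′))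
    from : s ≡ t × b ≡ b′ → footAt s b ≡ footAt t b′
    from (refl , refl) = refl

  fibre-meets-once : ∀ s a → (footAt s false == a) xor (footAt s true == a) ≡ (s == segOf a)
  fibre-meets-once s a rewrite sym (foot-η a)
                             | footAt-== s false (segOf a) (bitOf a) | footAt-== s true (segOf a) (bitOf a)
                             | segOf-footAt (segOf a) (bitOf a)
    with s == segOf a | bitOf a
  ... | true | true = refl
  ... | true | false = refl
  ... | false | _ = refl

  fibre-mem3 : ∀ a b c → Distinct (map₃ segOf (a , b , c)) → ∀ s →
               mem3 (footAt s false) a b c xor mem3 (footAt s true) a b c ≡ mem3 s (segOf a) (segOf b) (segOf c)
  fibre-mem3 a b c segs-distinct s = begin
    mem3 f₀ a b c xor mem3 f₁ a b c
      ≡⟨ cong₂ _xor_ (mem3-sum₃ f₀ feet-distinct) (mem3-sum₃ f₁ feet-distinct) ⟩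
    sum₃ (f₀ ==_) (a , b , c) xor sum₃ (f₁ ==_) (a , b , c)
      ≡⟨ solve 6 (λ a₀ b₀ c₀ a₁ b₁ c₁ → (a₀ :+ (b₀ :+ c₀)) :+ (a₁ :+ (b₁ :+ c₁)) := (a₀ :+ a₁) :+ ((b₀ :+ b₁) :+ (c₀ :+ c₁)))
               refl (f₀ == a) (f₀ == b) (f₀ == c) (f₁ == a) (f₁ == b) (f₁ == c) ⟩
    sum₃ (λ e → (f₀ == e) xor (f₁ == e)) (a , b , c)
      ≡⟨ cong₂ _xor_ (fibre-meets-once s a) (cong₂ _xor_ (fibre-meets-once s b) (fibre-meets-once s c)) ⟩
    sum₃ (s ==_) (map₃ segOf (a , b , c))
      ≡⟨ sym (mem3-sum₃ s segs-distinct) ⟩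
    mem3 s (segOf a) (segOf b) (segOf c) ∎
    where
    open ≡-Reasoning
    f₀ f₁ : Foot
    f₀ = footAt s false
    f₁ = footAt s true
    feet-distinct : Distinct (a , b , c)
    feet-distinct = Distinct-map₃⁻ segOf segs-distinct

  switch : (Seg → Bool) → Foot → Foot
  switch t f = footAt (segOf f) (bitOf f xor t (segOf f))

  segOf-switch : ∀ t f → segOf (switch t f) ≡ segOf f
  segOf-switch t f = segOf-footAt (segOf f) (bitOf f xor t (segOf f))

  bitOf-switch : ∀ t f → bitOf (switch t f) ≡ bitOf f xor t (segOf f)
  bitOf-switch t f = bitOf-footAt (segOf f) (bitOf f xor t (segOf f))

  switch-involutive : ∀ t f → switch t (switch t f) ≡ f
  switch-involutive t f = trans (cong₂ footAt (segOf-switch t f) bits) (foot-η f)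
    where
    bits : bitOf (switch t f) xor t (segOf (switch t f)) ≡ bitOf f
    bits rewrite bitOf-switch t f | segOf-switch t f =
      solve 2 (λ b x → (b :+ x) :+ x := b) refl (bitOf f) (t (segOf f))

  Spans : Fin N → Triple Seg → Set
  Spans i s = s ∈ orderings (triple i)

  spans? : ∀ i s → Dec (Spans i s)
  spans? i s = s ∈? orderings (triple i)
    where open DecMembership (≡-dec Fin._≟_ (≡-dec Fin._≟_ Fin._≟_)) using (_∈?_)

  spans-unique : ∀ {i j s} → Spans i s → Spans j s → i ≡ j
  spans-unique {i} {j} i-spans j-spans =
    triple-determines i j
      (All₃-orderings i-spans (All₃-orderings {P = _∈₃ triple j} (orderings-sym j-spans) triple-self))
    where
    triple-self : All₃ (_∈₃ triple j) (triple j)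
    triple-self = inj₁ refl , inj₂ (inj₁ refl) , inj₂ (inj₂ refl)

  Positive : (Fin N → Bool) → Triple Foot → Fin N → Set
  Positive tw fs i = Spans i (map₃ segOf fs) × sum₃ bitOf fs ≡ tw i

  -- Opaque: unfolding these decision procedures makes conversion checking very slow.
  opaque
    hyper : Seg → Seg → Seg → Bool
    hyper x y z = ⌊ any? (λ i → spans? i (x , y , z)) ⌋

    positive : (Fin N → Bool) → Foot → Foot → Foot → Bool
    positive tw a b c =
      ⌊ any? (λ i → spans? i (map₃ segOf (a , b , c)) ×-dec (sum₃ bitOf (a , b , c) Bool.≟ tw i)) ⌋

    positive-at : ∀ tw {i x y z} → Spans i (x , y , z) → ∀ b₁ b₂ b₃ →
                  positive tw (footAt x b₁) (footAt y b₂) (footAt z b₃) ≡ ⌊ b₁ xor (b₂ xor b₃) Bool.≟ tw i ⌋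
    positive-at tw {i} {x} {y} {z} i-spans b₁ b₂ b₃ = isYes-cong (mk⇔ to from) _ _
      where
      segs : map₃ segOf (footAt x b₁ , footAt y b₂ , footAt z b₃) ≡ (x , y , z)
      segs = cong₂ _,_ (segOf-footAt x b₁) (cong₂ _,_ (segOf-footAt y b₂) (segOf-footAt z b₃))
      bits : sum₃ bitOf (footAt x b₁ , footAt y b₂ , footAt z b₃) ≡ b₁ xor (b₂ xor b₃)
      bits = cong₂ _xor_ (bitOf-footAt x b₁) (cong₂ _xor_ (bitOf-footAt y b₂) (bitOf-footAt z b₃))
      to : ∃ (Positive tw (footAt x b₁ , footAt y b₂ , footAt z b₃)) → b₁ xor (b₂ xor b₃) ≡ tw i
      to (j , j-spans , eq) = trans (sym bits) (trans eq (cong tw (spans-unique (subst (Spans j) segs j-spans) i-spans)))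
      from : b₁ xor (b₂ xor b₃) ≡ tw i → ∃ (Positive tw (footAt x b₁ , footAt y b₂ , footAt z b₃))
      from eq = i , subst (Spans i) (sym segs) i-spans , trans bits eq

    hyper-triples : IsTripleSystem hyper
    hyper-triples =
      (λ a b c h → let (i , i-spans) = isYes⇒ (any? _) h in orderings-distinct (triple-distinct i) i-spans) ,
      (λ a b c → isYes-cong (mk⇔ (map₂ orderings-swap₁₂) (map₂ orderings-swap₁₂)) _ _) ,
      (λ a b c → isYes-cong (mk⇔ (map₂ orderings-swap₂₃) (map₂ orderings-swap₂₃)) _ _)

    positive-distinct : ∀ tw a b c → positive tw a b c ≡ true → Distinct (map₃ segOf (a , b , c))
    positive-distinct tw a b c p with isYes⇒ (any? _) p
    ... | i , i-spans , _ = orderings-distinct (triple-distinct i) i-spans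

    positive-triples : ∀ tw → IsTripleSystem (positive tw)
    positive-triples tw =
      (λ a b c p → Distinct-map₃⁻ segOf (positive-distinct tw a b c p)) ,
      (λ a b c → isYes-cong (mk⇔ (map₂ (swap₁₂ {a} {b} {c})) (map₂ (swap₁₂ {b} {a} {c}))) _ _) ,
      (λ a b c → isYes-cong (mk⇔ (map₂ (swap₂₃ {a} {b} {c})) (map₂ (swap₂₃ {a} {c} {b}))) _ _)
      where
      swap₁₂ : ∀ {a b c i} → Positive tw (a , b , c) i → Positive tw (b , a , c) i
      swap₁₂ {a} {b} {c} = Product.map orderings-swap₁₂ (trans (orderings-sum₃ bitOf {t = a , b , c} ∈qpr))
      swap₂₃ : ∀ {a b c i} → Positive tw (a , b , c) i → Positive tw (a , c , b) i
      swap₂₃ {a} {b} {c} = Product.map orderings-swap₂₃ (trans (orderings-sum₃ bitOf {t = a , b , c} ∈prq))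

    hyper⇒spans : ∀ {x y z} → hyper x y z ≡ true → ∃ λ i → Spans i (x , y , z)
    hyper⇒spans = isYes⇒ (any? _)

    positive⇒hyper : ∀ tw a b c → positive tw a b c ≡ true → hyper (segOf a) (segOf b) (segOf c) ≡ true
    positive⇒hyper tw a b c p with isYes⇒ (any? _) p
    ... | i , i-spans , _ = isYes-true (any? _) (i , i-spans)

    positive-switch : ∀ tw tw′ t a b c →
      (∀ i → Spans i (map₃ segOf (a , b , c)) → tw′ i ≡ sum₃ t (triple i) xor tw i) →
      positive tw′ (switch t a) (switch t b) (switch t c) ≡ positive tw a b c
    positive-switch tw tw′ t a b c twists = isYes-cong (mk⇔ to from) _ _
      where
      segs : map₃ segOf (switch t a , switch t b , switch t c) ≡ map₃ segOf (a , b , c)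
      segs = cong₂ _,_ (segOf-switch t a) (cong₂ _,_ (segOf-switch t b) (segOf-switch t c))
      bits : sum₃ bitOf (switch t a , switch t b , switch t c) ≡ sum₃ bitOf (a , b , c) xor sum₃ t (map₃ segOf (a , b , c))
      bits rewrite bitOf-switch t a | bitOf-switch t b | bitOf-switch t c =
        solve 6 (λ a b c x y z → (a :+ x) :+ ((b :+ y) :+ (c :+ z)) := (a :+ (b :+ c)) :+ (x :+ (y :+ z)))
              refl (bitOf a) (bitOf b) (bitOf c) (t (segOf a)) (t (segOf b)) (t (segOf c))
      untwist : ∀ {i} → Spans i (map₃ segOf (a , b , c)) →
                (sum₃ bitOf (switch t a , switch t b , switch t c) ≡ tw′ i) ⇔ (sum₃ bitOf (a , b , c) ≡ tw i)
      untwist {i} i-spans rewrite bits | twists i i-spans | orderings-sum₃ t i-spans = xor-cancel-⇔ _ _ _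
      to : ∃ (Positive tw′ (switch t a , switch t b , switch t c)) → ∃ (Positive tw (a , b , c))
      to (i , i-spans , eq) = i , subst (Spans i) segs i-spans , Equivalence.to (untwist (subst (Spans i) segs i-spans)) eq
      from : ∃ (Positive tw (a , b , c)) → ∃ (Positive tw′ (switch t a , switch t b , switch t c))
      from (i , i-spans , eq) = i , subst (Spans i) (sym segs) i-spans , Equivalence.from (untwist i-spans) eq

  two-feet-over : ∀ s → count (λ f → segOf f == s) ≡ 2
  two-feet-over s = trans (count-++ M (λ f → segOf f == s)) (cong₂ _+_ (half false) (half true))
    where
    half : ∀ b → count (λ t → segOf (footAt t b) == s) ≡ 1
    half b = trans (count-cong (λ t → trans (cong (_== s) (segOf-footAt t b)) (sym (∧-identityʳ (t == s)))))
                   (count-indicator s (λ _ → true))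

  count-fibre : ∀ z (q : Foot → Bool) → count (λ c → (segOf c == z) ∧ q c) ≡ sumBool (λ b → indicator (q (footAt z b)))
  count-fibre z q = trans (count-++ M (λ c → (segOf c == z) ∧ q c)) (cong₂ _+_ (half false) (half true))
    where
    half : ∀ b → count (λ t → (segOf (footAt t b) == z) ∧ q (footAt t b)) ≡ indicator (q (footAt z b))
    half b = trans (count-cong (λ t → cong (λ t′ → (t′ == z) ∧ q (footAt t b)) (segOf-footAt t b)))
                   (count-indicator z (λ t → q (footAt t b)))

  sumFin-fibre : ∀ z (g : Foot → ℕ) → sumFin (λ c → if segOf c == z then g c else 0) ≡ sumBool (λ b → g (footAt z b))
  sumFin-fibre z g = trans (sumFin-++ M (λ c → if segOf c == z then g c else 0)) (cong₂ _+_ (half false) (half true))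
    where
    half : ∀ b → sumFin (λ t → if segOf (footAt t b) == z then g (footAt t b) else 0) ≡ g (footAt z b)
    half b = trans (sumFin-cong (λ t → cong (λ t′ → if t′ == z then g (footAt t b) else 0) (segOf-footAt t b)))
                   (sumFin-indicator z (λ t → g (footAt t b)))

  count3-fibres : ∀ x y z (G : Foot → Foot → Foot → Bool) →
    count3 (λ a b c → (segOf a == x) ∧ (segOf b == y) ∧ (segOf c == z) ∧ G a b c) ≡
    sumBool λ b₁ → sumBool λ b₂ → sumBool λ b₃ → indicator (G (footAt x b₁) (footAt y b₂) (footAt z b₃))
  count3-fibres x y z G = begin
    sumFin (λ a → sumFin (λ b → count (λ c → (segOf a == x) ∧ (segOf b == y) ∧ (segOf c == z) ∧ G a b c)))
      ≡⟨ sumFin-cong (λ a → trans (sumFin-cong (λ b → count-guard (segOf a == x) (λ c → (segOf b == y) ∧ rest a b c)))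
                                  (sumFin-guard (segOf a == x) (λ b → count (λ c → (segOf b == y) ∧ rest a b c)))) ⟩
    sumFin (λ a → if segOf a == x then sumFin (λ b → count (λ c → (segOf b == y) ∧ rest a b c)) else 0)
      ≡⟨ sumFin-fibre x (λ a → sumFin (λ b → count (λ c → (segOf b == y) ∧ rest a b c))) ⟩
    sumBool (λ b₁ → sumFin (λ b → count (λ c → (segOf b == y) ∧ rest (footAt x b₁) b c)))
      ≡⟨ sumBool-cong (λ b₁ → trans (sumFin-cong (λ b → count-guard (segOf b == y) (rest (footAt x b₁) b)))
                                    (sumFin-fibre y (λ b → count (rest (footAt x b₁) b)))) ⟩
    sumBool (λ b₁ → sumBool (λ b₂ → count (rest (footAt x b₁) (footAt y b₂))))
      ≡⟨ sumBool-cong (λ b₁ → sumBool-cong (λ b₂ → count-fibre z (G (footAt x b₁) (footAt y b₂)))) ⟩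
    (sumBool λ b₁ → sumBool λ b₂ → sumBool λ b₃ → indicator (G (footAt x b₁) (footAt y b₂) (footAt z b₃)))
      ∎
    where
    open ≡-Reasoning
    rest : Foot → Foot → Foot → Bool
    rest a b c = (segOf c == z) ∧ G a b c

  four-positive-lifts : ∀ tw x y z → hyper x y z ≡ true →
            count3 (λ a b c → (segOf a == x) ∧ (segOf b == y) ∧ (segOf c == z) ∧ positive tw a b c) ≡ 4
  four-positive-lifts tw x y z h with hyper⇒spans h
  ... | i , i-spans =
    trans (count3-fibres x y z (positive tw))
          (trans (sumBool-cong λ b₁ → sumBool-cong λ b₂ → sumBool-cong λ b₃ →
                    cong indicator (positive-at tw i-spans b₁ b₂ b₃))
                 (half-of-eight (tw i)))
    where
    half-of-eight : ∀ w → (sumBool λ b₁ → sumBool λ b₂ → sumBool λ b₃ → indicator ⌊ b₁ xor (b₂ xor b₃) Bool.≟ w ⌋) ≡ 4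
    half-of-eight false = refl
    half-of-eight true = refl

  positive-even-difference : ∀ tw a b c a′ b′ c′ → positive tw a b c ≡ true → positive tw a′ b′ c′ ≡ true →
    (∀ s → mem3 s (segOf a) (segOf b) (segOf c) ≡ mem3 s (segOf a′) (segOf b′) (segOf c′)) →
    2 ∣ count (λ f → mem3 f a b c xor mem3 f a′ b′ c′)
  positive-even-difference tw a b c a′ b′ c′ p p′ same-segments =
    subst (2 ∣_) (sym (trans (count-++ M Δ) (cong (_+ count (λ s → Δ (footAt s true))) (count-cong Δ-fibre))))
          (n∣n+n (count (λ s → Δ (footAt s true))))
    where
    Δ : Foot → Bool
    Δ f = mem3 f a b c xor mem3 f a′ b′ c′
    Δ-fibre : ∀ s → Δ (footAt s false) ≡ Δ (footAt s true)
    Δ-fibre s = xor-exchange (mem3 (footAt s false) a b c) (mem3 (footAt s true) a b c)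
                             (mem3 (footAt s false) a′ b′ c′) (mem3 (footAt s true) a′ b′ c′)
      (trans (fibre-mem3 a b c (positive-distinct tw a b c p) s)
             (trans (same-segments s) (sym (fibre-mem3 a′ b′ c′ (positive-distinct tw a′ b′ c′ p′) s))))

  member : Seg → Fin (2 ^ M) → Bool
  member s X = Inverse.to 2↔Bool (finToFun X s)

  encode : (Seg → Bool) → Fin (2 ^ M)
  encode U = funToFin (Inverse.from 2↔Bool ∘ U)

  member-encode : ∀ U s → member s (encode U) ≡ U s
  member-encode U s = trans (cong (Inverse.to 2↔Bool) (finToFun-funToFin (Inverse.from 2↔Bool ∘ U) s))
                            (Inverse.strictlyInverseˡ 2↔Bool (U s))

  encode-unique : ∀ U X → (∀ s → member s X ≡ U s) → X ≡ encode U
  encode-unique U X X-codes-U = trans (sym (funToFin-finToFin {M} {2} X)) (funToFin-cong λ s →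
    trans (sym (Inverse.strictlyInverseʳ 2↔Bool (finToFun X s))) (cong (Inverse.from 2↔Bool) (X-codes-U s)))

  _≤ᵇ_ : Seg → Seg → Bool
  s ≤ᵇ t = ⌊ s ≤? t ⌋

  ≤ᵇ-total : ∀ s t → (s ≤ᵇ t ∨ t ≤ᵇ s) ≡ true
  ≤ᵇ-total s t with Finₚ.≤-total s t
  ... | inj₁ s≤t rewrite isYes-true (s ≤? t) s≤t = refl
  ... | inj₂ t≤s rewrite isYes-true (t ≤? s) t≤s = ∨-zeroʳ _

  cfi : (Fin N → Bool) → Multipede4
  cfi tw = record
    { nSeg = M ; nFoot = M + M ; nSet = 2 ^ M
    ; S = segOf ; H = hyper ; P = positive tw ; le = _≤ᵇ_ ; ε = member ; shoe = footAt zero false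
    ; twoFeet = two-feet-over
    ; H-triples = hyper-triples
    ; P-triples = positive-triples tw
    ; pos⇒hyper = positive⇒hyper tw
    ; fourPos = four-positive-lifts tw
    ; evenDiff = positive-even-difference tw
    ; le-refl = λ s → isYes-true (s ≤? s) Finₚ.≤-refl
    ; le-antisym = λ s t s≤t t≤s → Finₚ.≤-antisym (isYes⇒ (s ≤? t) s≤t) (isYes⇒ (t ≤? s) t≤s)
    ; le-trans = λ s t u s≤t t≤u → isYes-true (s ≤? u) (Finₚ.≤-trans (isYes⇒ (s ≤? t) s≤t) (isYes⇒ (t ≤? u) t≤u))
    ; le-total = ≤ᵇ-total
    ; sets-ex = λ U → encode U , member-encode U
    ; sets-uniq = λ U X Y X-codes-U Y-codes-U → trans (encode-unique U X X-codes-U) (sym (encode-unique U Y Y-codes-U))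
    ; shoe-first = λ s → trans (cong (_≤ᵇ s) (segOf-footAt zero false)) (isYes-true (zero {m} ≤? s) ℕ.z≤n)
    }

-- The base graph

module Graph (k : ℕ) where

  n : ℕ
  n = ℕ.suc (ℕ.suc k)

  -- Node (b , v , j) is vertex j of the cycle ("row") (b , v); the edge cycle nd joins nd to the
  -- next vertex of its row, and link (a , c) joins (false , a , c) to (true , c , a).
  Node : Set
  Node = Bool × Fin n × Fin n

  Link : Set
  Link = Fin n × Fin n

  linkOf : Node → Link
  linkOf (false , v , j) = v , j
  linkOf (true , v , j) = j , v

  opposite : Node → Node
  opposite (b , v , j) = not b , j , v

  along : Node → Fin n → Node
  along (b , v , _) w = b , v , w

  Edge : Set
  Edge = Node ⊎ Link

  pattern cycle nd = inj₁ nd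
  pattern link l = inj₂ l

  prevInRow : Node → Node
  prevInRow (b , v , j) = b , v , prev j

  edgesAt : Node → Triple Edge
  edgesAt nd = cycle (prevInRow nd) , cycle nd , link (linkOf nd)

  _≟ₙ_ : DecidableEquality Node
  _≟ₙ_ = ≡-dec Bool._≟_ (≡-dec Fin._≟_ Fin._≟_)

  _≟ₗ_ : DecidableEquality Link
  _≟ₗ_ = ≡-dec Fin._≟_ Fin._≟_

  ≟ₙ-split : ∀ b v j b′ v′ j′ → ⌊ (b , v , j) ≟ₙ (b′ , v′ , j′) ⌋ ≡ ⌊ b Bool.≟ b′ ⌋ ∧ ((v == v′) ∧ (j == j′))
  ≟ₙ-split b v j b′ v′ j′ =
    trans (isYes-cong (mk⇔ (λ { refl → refl , refl , refl }) (λ { (refl , refl , refl) → refl }))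
                      ((b , v , j) ≟ₙ (b′ , v′ , j′)) ((b Bool.≟ b′) ×-dec ((v Fin.≟ v′) ×-dec (j Fin.≟ j′))))
          (trans (isYes-× (b Bool.≟ b′) _) (cong (⌊ b Bool.≟ b′ ⌋ ∧_) (isYes-× (v Fin.≟ v′) (j Fin.≟ j′))))

  ≟ₗ-split : ∀ a c a′ c′ → ⌊ (a , c) ≟ₗ (a′ , c′) ⌋ ≡ (a == a′) ∧ (c == c′)
  ≟ₗ-split a c a′ c′ =
    trans (isYes-cong (mk⇔ (λ { refl → refl , refl }) (λ { (refl , refl) → refl }))
                      ((a , c) ≟ₗ (a′ , c′)) ((a Fin.≟ a′) ×-dec (c Fin.≟ c′)))
          (isYes-× (a Fin.≟ a′) (c Fin.≟ c′))

  linkOf-shared : ∀ nd nd′ → ⌊ linkOf nd ≟ₗ linkOf nd′ ⌋ ≡ ⌊ nd ≟ₙ nd′ ⌋ xor ⌊ nd ≟ₙ opposite nd′ ⌋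
  linkOf-shared (b , v , j) (b′ , v′ , j′) rewrite ≟ₙ-split b v j b′ v′ j′ | ≟ₙ-split b v j (not b′) j′ v′
    with b | b′
  ... | false | false rewrite ≟ₗ-split v j v′ j′ = sym (xor-identityʳ _)
  ... | false | true rewrite ≟ₗ-split v j j′ v′ = refl
  ... | true | false rewrite ≟ₗ-split j v v′ j′ = ∧-comm (j == v′) (v == j′)
  ... | true | true rewrite ≟ₗ-split j v j′ v′ = trans (∧-comm (j == j′) (v == v′)) (sym (xor-identityʳ _))

  N : ℕ
  N = 2 ℕ.* (n ℕ.* n)

  nodes : Fin N ↔ Node
  nodes = ↔-trans *↔× (2↔Bool ×-↔ *↔×)

  m : ℕ
  m = N + n ℕ.* n

  edges : Fin m ↔ Edge
  edges = ↔-trans +↔⊎ (nodes ⊎-↔ *↔×)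

  node : Fin N → Node
  node = Inverse.to nodes

  node-injective : ∀ {i j} → node i ≡ node j → i ≡ j
  node-injective = Injection.injective (Inverse⇒Injection nodes)

  -- Segment zero lies in no hyperedge: it carries the shoe, and switchOn never flips it.
  Seg : Set
  Seg = Fin (ℕ.suc m)

  segment : Edge → Seg
  segment e = suc (Inverse.from edges e)

  segment-injective : ∀ {e e′} → segment e ≡ segment e′ → e ≡ e′
  segment-injective = Injection.injective (Inverse⇒Injection (↔-sym edges)) ∘ suc-injective

  edgeOf : Fin m → Edge
  edgeOf = Inverse.to edges

  segment-edgeOf : ∀ i → segment (edgeOf i) ≡ suc i
  segment-edgeOf i = cong suc (Inverse.strictlyInverseʳ edges i)

  switchOn : (Edge → Bool) → Seg → Bool
  switchOn F zero = false
  switchOn F (suc i) = F (edgeOf i)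

  switchOn-segment : ∀ F e → switchOn F (segment e) ≡ F e
  switchOn-segment F e = cong F (Inverse.strictlyInverseˡ edges e)

  triple : Fin N → Triple Seg
  triple i = map₃ segment (edgesAt (node i))

  sum₃-switchOn : ∀ F nd → sum₃ (switchOn F) (map₃ segment (edgesAt nd)) ≡ sum₃ F (edgesAt nd)
  sum₃-switchOn F nd = cong₂ _xor_ (switchOn-segment F (cycle (prevInRow nd)))
                             (cong₂ _xor_ (switchOn-segment F (cycle nd)) (switchOn-segment F (link (linkOf nd))))

  edgesAt-distinct : ∀ nd → Distinct (edgesAt nd)
  edgesAt-distinct (b , v , j) = (λ eq → prev-≢ j (,-injectiveʳ (,-injectiveʳ (inj₁-injective eq)))) , (λ ()) , (λ ())

  triple-distinct : ∀ i → Distinct (triple i)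
  triple-distinct i = Distinct-map₃ segment-injective (edgesAt-distinct (node i))

  linkOf-injective : ∀ b v {j j′} → linkOf (b , v , j) ≡ linkOf (b , v , j′) → j ≡ j′
  linkOf-injective false v eq = ,-injectiveʳ eq
  linkOf-injective true v eq = ,-injectiveˡ eq

  edgesAt-determine : ∀ nd nd′ → cycle nd ∈₃ edgesAt nd′ → link (linkOf nd) ∈₃ edgesAt nd′ → nd ≡ nd′
  edgesAt-determine _ _ (inj₂ (inj₁ refl)) _ = refl
  edgesAt-determine _ _ (inj₂ (inj₂ ())) _
  edgesAt-determine _ _ (inj₁ refl) (inj₁ ())
  edgesAt-determine _ _ (inj₁ refl) (inj₂ (inj₁ ()))
  edgesAt-determine (b , v , _) (_ , _ , j′) (inj₁ refl) (inj₂ (inj₂ eq)) =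
    cong (λ j → b , v , j) (linkOf-injective b v (inj₂-injective eq))

  triple-determines : ∀ i j → All₃ (_∈₃ triple j) (triple i) → i ≡ j
  triple-determines i j (_ , on-cycle , on-link) = node-injective
    (edgesAt-determine (node i) (node j) (∈₃-map₃⁻ segment-injective on-cycle) (∈₃-map₃⁻ segment-injective on-link))

  open CFI m N triple triple-distinct triple-determines public hiding (Seg)

  ⨁ : (Node → Bool) → Bool
  ⨁ f = parity (λ v → parity (λ j → f (false , v , j))) xor parity (λ v → parity (λ j → f (true , v , j)))

  ⨁-cong : ∀ {f g} → (∀ nd → f nd ≡ g nd) → ⨁ f ≡ ⨁ g
  ⨁-cong f≗g = cong₂ _xor_ (parity-cong λ v → parity-cong λ j → f≗g (false , v , j))
                            (parity-cong λ v → parity-cong λ j → f≗g (true , v , j))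

  ⨁-xor : ∀ f g → ⨁ (λ nd → f nd xor g nd) ≡ ⨁ f xor ⨁ g
  ⨁-xor f g = trans (cong₂ _xor_ (layer false) (layer true))
                    (solve 4 (λ a b c d → (a :+ b) :+ (c :+ d) := (a :+ c) :+ (b :+ d)) refl
                           (Σf false) (Σg false) (Σf true) (Σg true))
    where
    Σf Σg : Bool → Bool
    Σf b = parity (λ v → parity (λ j → f (b , v , j)))
    Σg b = parity (λ v → parity (λ j → g (b , v , j)))
    layer : ∀ b → parity (λ v → parity (λ j → f (b , v , j) xor g (b , v , j))) ≡ Σf b xor Σg b
    layer b = trans (parity-cong λ v → parity-xor (λ j → f (b , v , j)) (λ j → g (b , v , j)))
                    (parity-xor (λ v → parity (λ j → f (b , v , j))) (λ v → parity (λ j → g (b , v , j))))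

  ⨁-prevInRow : ∀ f → ⨁ (f ∘ prevInRow) ≡ ⨁ f
  ⨁-prevInRow f = cong₂ _xor_ (parity-cong λ v → parity-prev (λ j → f (false , v , j)))
                         (parity-cong λ v → parity-prev (λ j → f (true , v , j)))

  ⨁-links : ∀ g → ⨁ (g ∘ linkOf) ≡ false
  ⨁-links g = trans (cong (parity (λ v → parity (λ j → g (v , j))) xor_) (parity-comm (λ v j → g (j , v))))
                    (xor-same (parity (λ v → parity (λ j → g (v , j)))))

  ⨁-edgesAt : ∀ g → ⨁ (λ nd → sum₃ g (edgesAt nd)) ≡ false
  ⨁-edgesAt g = begin
    ⨁ (λ nd → sum₃ g (edgesAt nd))
      ≡⟨ trans (⨁-xor (g ∘ cycle ∘ prevInRow) (λ nd → g (cycle nd) xor g (link (linkOf nd))))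
               (cong (⨁ (g ∘ cycle ∘ prevInRow) xor_) (⨁-xor (g ∘ cycle) (g ∘ link ∘ linkOf))) ⟩
    ⨁ (g ∘ cycle ∘ prevInRow) xor (⨁ (g ∘ cycle) xor ⨁ (g ∘ link ∘ linkOf))
      ≡⟨ cong₂ (λ x y → x xor (⨁ (g ∘ cycle) xor y)) (⨁-prevInRow (g ∘ cycle)) (⨁-links (g ∘ link)) ⟩
    ⨁ (g ∘ cycle) xor (⨁ (g ∘ cycle) xor false)
      ≡⟨ trans (cong (⨁ (g ∘ cycle) xor_) (xor-identityʳ (⨁ (g ∘ cycle)))) (xor-same (⨁ (g ∘ cycle))) ⟩
    false ∎
    where open ≡-Reasoning

  ⨁-indicator : ∀ r → ⨁ (λ nd → ⌊ nd ≟ₙ r ⌋) ≡ true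
  ⨁-indicator (b₀ , v₀ , j₀) = trans (cong₂ _xor_ (row-sum false) (row-sum true)) (exactly-one b₀)
    where
    row-sum : ∀ b → parity (λ v → parity (λ j → ⌊ (b , v , j) ≟ₙ (b₀ , v₀ , j₀) ⌋)) ≡ ⌊ b Bool.≟ b₀ ⌋
    row-sum b = begin
      parity (λ v → parity (λ j → ⌊ (b , v , j) ≟ₙ (b₀ , v₀ , j₀) ⌋))
        ≡⟨ parity-cong (λ v → parity-cong λ j → trans (≟ₙ-split b v j b₀ v₀ j₀)
             (solve 3 (λ x y z → x :* (y :* z) := z :* (x :* y)) refl ⌊ b Bool.≟ b₀ ⌋ (v == v₀) (j == j₀))) ⟩
      parity (λ v → parity (λ j → (j == j₀) ∧ (⌊ b Bool.≟ b₀ ⌋ ∧ (v == v₀))))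
        ≡⟨ parity-cong (λ v → trans (parity-indicator j₀ _) (∧-comm ⌊ b Bool.≟ b₀ ⌋ (v == v₀))) ⟩
      parity (λ v → (v == v₀) ∧ ⌊ b Bool.≟ b₀ ⌋)
        ≡⟨ parity-indicator v₀ _ ⟩
      ⌊ b Bool.≟ b₀ ⌋ ∎
      where open ≡-Reasoning
    exactly-one : ∀ b₀ → ⌊ false Bool.≟ b₀ ⌋ xor ⌊ true Bool.≟ b₀ ⌋ ≡ true
    exactly-one false = refl
    exactly-one true = refl

  twist : Node → Fin N → Bool
  twist r i = ⌊ node i ≟ₙ r ⌋

  r₀ : Node
  r₀ = false , zero , zero

  untwisted twisted : Multipede4
  untwisted = cfi (λ _ → false)
  twisted = cfi (twist r₀)

  -- The cycle edges of a row lying between positions j₀ and w.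
  arc : Fin n → Fin n → Fin n → Bool
  arc j₀ w j = ⌊ j₀ ≤? j ⌋ xor ⌊ w ≤? j ⌋

  arc-boundary : ∀ j₀ w j → arc j₀ w (prev j) xor arc j₀ w j ≡ (j == j₀) xor (j == w)
  arc-boundary j₀ w j = begin
    arc j₀ w (prev j) xor arc j₀ w j
      ≡⟨ solve 4 (λ a′ w′ a w → (a′ :+ w′) :+ (a :+ w) := (a′ :+ a) :+ (w′ :+ w)) refl
               ⌊ j₀ ≤? prev j ⌋ ⌊ w ≤? prev j ⌋ ⌊ j₀ ≤? j ⌋ ⌊ w ≤? j ⌋ ⟩
    (⌊ j₀ ≤? prev j ⌋ xor ⌊ j₀ ≤? j ⌋) xor (⌊ w ≤? prev j ⌋ xor ⌊ w ≤? j ⌋)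
      ≡⟨ cong₂ _xor_ (≤?-prev j₀ j) (≤?-prev w j) ⟩
    ((j == j₀) xor (j == zero)) xor ((j == w) xor (j == zero))
      ≡⟨ solve 3 (λ a w z → (a :+ z) :+ (w :+ z) := a :+ w) refl (j == j₀) (j == w) (j == zero) ⟩
    (j == j₀) xor (j == w) ∎
    where open ≡-Reasoning

  pathSwitch : Node → Fin n → Edge → Bool
  pathSwitch (b₀ , v₀ , j₀) w (cycle (b , v , j)) = (⌊ b Bool.≟ b₀ ⌋ ∧ (v == v₀)) ∧ arc j₀ w j
  pathSwitch r w (link l) = ⌊ l ≟ₗ linkOf (along r w) ⌋

  pathSwitch-boundary : ∀ r w nd →
    sum₃ (pathSwitch r w) (edgesAt nd) ≡ ⌊ nd ≟ₙ r ⌋ xor ⌊ nd ≟ₙ opposite (along r w) ⌋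
  pathSwitch-boundary (b₀ , v₀ , j₀) w (b , v , j)
    rewrite linkOf-shared (b , v , j) (b₀ , v₀ , w) | ≟ₙ-split b v j b₀ v₀ w | ≟ₙ-split b v j b₀ v₀ j₀ = begin
    (B ∧ V) ∧ arc j₀ w (prev j) xor ((B ∧ V) ∧ arc j₀ w j xor (B ∧ (V ∧ (j == w)) xor O))
      ≡⟨ solve 6 (λ x y a′ a z o → (x :* y) :* a′ :+ ((x :* y) :* a :+ (x :* (y :* z) :+ o))
                                    := (x :* y) :* (a′ :+ a) :+ (x :* (y :* z) :+ o))
               refl B V (arc j₀ w (prev j)) (arc j₀ w j) (j == w) O ⟩
    (B ∧ V) ∧ (arc j₀ w (prev j) xor arc j₀ w j) xor (B ∧ (V ∧ (j == w)) xor O)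
      ≡⟨ cong (λ a → (B ∧ V) ∧ a xor (B ∧ (V ∧ (j == w)) xor O)) (arc-boundary j₀ w j) ⟩
    (B ∧ V) ∧ ((j == j₀) xor (j == w)) xor (B ∧ (V ∧ (j == w)) xor O)
      ≡⟨ solve 5 (λ x y a z o → (x :* y) :* (a :+ z) :+ (x :* (y :* z) :+ o) := x :* (y :* a) :+ o)
               refl B V (j == j₀) (j == w) O ⟩
    B ∧ (V ∧ (j == j₀)) xor O ∎
    where
    open ≡-Reasoning
    B V O : Bool
    B = ⌊ b Bool.≟ b₀ ⌋
    V = v == v₀
    O = ⌊ (b , v , j) ≟ₙ opposite (b₀ , v₀ , w) ⌋

  OffRow : Node → Seg → Set
  OffRow r s = ∀ j → s ≢ segment (cycle (along r j))

  blockedBy : Node → Edge → Fin n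
  blockedBy r (cycle (_ , v , _)) = v
  blockedBy (false , _ , _) (link (_ , c)) = c
  blockedBy (true , _ , _) (link (a , _)) = a

  blocked : Node → Seg → Fin n
  blocked r zero = zero
  blocked r (suc i) = blockedBy r (edgeOf i)

  blocked-segment : ∀ r e → blocked r (segment e) ≡ blockedBy r e
  blocked-segment r e = cong (blockedBy r) (Inverse.strictlyInverseˡ edges e)

  blockedBy-linkOf : ∀ r w → blockedBy r (link (linkOf (along r w))) ≡ w
  blockedBy-linkOf (false , _ , _) w = refl
  blockedBy-linkOf (true , _ , _) w = refl

  pathSwitch-off : ∀ r w s → OffRow r s → blocked r s ≢ w → switchOn (pathSwitch r w) s ≡ false
  pathSwitch-off r w zero _ _ = refl
  pathSwitch-off r w (suc i) off-row unblocked =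
    edge-off (edgeOf i) (λ j eq → off-row j (trans (sym (segment-edgeOf i)) (cong segment eq))) unblocked
    where
    edge-off : ∀ e → (∀ j → e ≢ cycle (along r j)) → blockedBy r e ≢ w → pathSwitch r w e ≡ false
    edge-off (cycle (b , v , j)) e-off _ with b Bool.≟ proj₁ r | v Fin.≟ proj₁ (proj₂ r)
    ... | yes refl | yes refl = ⊥-elim (e-off j refl)
    ... | yes _ | no _ = refl
    ... | no _ | _ = refl
    edge-off (link l) _ e-unblocked with l ≟ₗ linkOf (along r w)
    ... | yes refl = ⊥-elim (e-unblocked (blockedBy-linkOf r w))
    ... | no _ = refl

  off-row-after : ∀ r w s → blocked r s ≢ w → OffRow (opposite (along r w)) s
  off-row-after (b₀ , v₀ , j₀) w s unblocked j eq =
    unblocked (trans (cong (blocked (b₀ , v₀ , j₀)) eq) (blocked-segment (b₀ , v₀ , j₀) (cycle (not b₀ , w , j))))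

  module _ (iso : Iso untwisted twisted) where
    open Iso iso

    flipped : Seg → Bool
    flipped s = bitOf (φ (footAt s false))

    φ-footAt : ∀ s → φ (footAt s false) ≡ footAt s (flipped s)
    φ-footAt s = trans (sym (foot-η _)) (cong (λ s′ → footAt s′ (flipped s))
      (trans (pres-S (footAt s false)) (trans (order-automorphism-id segs pres-le _) (segOf-footAt s false))))

    twist-at : ∀ i → sum₃ flipped (triple i) ≡ twist r₀ i
    twist-at i = isYes⇒ (sum₃ flipped (triple i) Bool.≟ twist r₀ i) (begin
      ⌊ sum₃ flipped (triple i) Bool.≟ twist r₀ i ⌋
        ≡⟨ sym (positive-at (twist r₀) {i} ∈pqr (flipped x) (flipped y) (flipped z)) ⟩
      positive (twist r₀) (footAt x (flipped x)) (footAt y (flipped y)) (footAt z (flipped z))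
        ≡⟨ sym (cong₂ (λ a bc → positive (twist r₀) a (proj₁ bc) (proj₂ bc))
                      (φ-footAt x) (cong₂ _,_ (φ-footAt y) (φ-footAt z))) ⟩
      positive (twist r₀) (φ (footAt x false)) (φ (footAt y false)) (φ (footAt z false))
        ≡⟨ pres-P (footAt x false) (footAt y false) (footAt z false) ⟩
      positive (λ _ → false) (footAt x false) (footAt y false) (footAt z false)
        ≡⟨ positive-at (λ _ → false) {i} ∈pqr false false false ⟩
      true ∎)
      where
      open ≡-Reasoning
      x y z : Seg
      x = proj₁ (triple i)
      y = proj₁ (proj₂ (triple i))
      z = proj₂ (proj₂ (triple i))

    twist-balanced : ∀ nd → ⌊ nd ≟ₙ r₀ ⌋ ≡ sum₃ (flipped ∘ segment) (edgesAt nd)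
    twist-balanced nd = subst (λ nd′ → ⌊ nd′ ≟ₙ r₀ ⌋ ≡ sum₃ (flipped ∘ segment) (edgesAt nd′))
                              (Inverse.strictlyInverseˡ nodes nd) (sym (twist-at (Inverse.from nodes nd)))

  untwisted-≇-twisted : ¬ Iso untwisted twisted
  untwisted-≇-twisted iso = true≢false (begin
    true                                               ≡⟨ sym (⨁-indicator r₀) ⟩
    ⨁ (λ nd → ⌊ nd ≟ₙ r₀ ⌋)                            ≡⟨ ⨁-cong (twist-balanced iso) ⟩
    ⨁ (λ nd → sum₃ (flipped iso ∘ segment) (edgesAt nd)) ≡⟨ ⨁-edgesAt (flipped iso ∘ segment) ⟩
    false                                              ∎)
    where
    open ≡-Reasoning
    true≢false : true ≢ false
    true≢false ()

-- Duplicator's strategy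

module Game (k : ℕ) where
  open Graph k public

  relabel : (Seg → Bool) → ∀ s → Carrier untwisted untwisted s → Carrier untwisted twisted s
  relabel t (left , _) c = c
  relabel t (right , seg) c = c
  relabel t (right , foot) f = switch t f
  relabel t (right , set) c = c

  open SortwiseMap using (mapVal; EmbeddingAt; atoms-agree)

  relabel-agree : ∀ {t t′} v → (∀ {f} → get right foot v ≡ just f → t (segOf f) ≡ t′ (segOf f)) →
                  mapVal (relabel t) v ≡ mapVal (relabel t′) v
  relabel-agree ((left , _) , _) _ = refl
  relabel-agree ((right , seg) , _) _ = refl
  relabel-agree ((right , foot) , f) agree = cong (λ b → (right , foot) , footAt (segOf f) (bitOf f xor b)) (agree refl)
  relabel-agree ((right , set) , _) _ = refl

  PebbleOffRow : Node → Val untwisted untwisted → Set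
  PebbleOffRow r v = ∀ {f} → get right foot v ≡ just f → OffRow r (segOf f)

  record Good (ρ : Assignment k untwisted untwisted) (ρ′ : Assignment k untwisted twisted) : Set where
    field
      switches : Seg → Bool
      twistNode : Node
      relabelled : ∀ y → ρ′ y ≡ mapVal (relabel switches) (ρ y)
      shoe-unswitched : switches zero ≡ false
      twist-moved : ∀ i → twist r₀ i ≡ sum₃ switches (triple i) xor twist twistNode i
      pebbles-off-row : ∀ y → PebbleOffRow twistNode (ρ y)

  module _ {ρ ρ′} (good : Good ρ ρ′) where
    open Good good

    not-twisted-at : ∀ {i a b c} → Spans i (map₃ segOf (a , b , c)) → All₃ (OffRow twistNode) (map₃ segOf (a , b , c)) →
                     twist twistNode i ≡ false
    not-twisted-at {i} i-spans off-row = isYes-false (node i ≟ₙ twistNode) λ { refl →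
      proj₁ (proj₂ (All₃-orderings {P = OffRow twistNode} i-spans off-row)) (proj₂ (proj₂ twistNode)) refl }

    embedding : EmbeddingAt (relabel switches) ρ
    embedding = record
      { injective = injective
      ; S-commutes = λ { left f → refl ; right f → segOf-switch switches f }
      ; H-preserved = λ { left _ _ _ → refl ; right _ _ _ → refl }
      ; P-preserved = P-preserved
      ; le-preserved = λ { left _ _ → refl ; right _ _ → refl }
      ; ε-preserved = λ { left _ _ → refl ; right _ _ → refl }
      ; shoe-preserved = λ { left → refl ; right → shoe-fixed }
      }
      where
      injective : ∀ s {c c′} → relabel switches s c ≡ relabel switches s c′ → c ≡ c′
      injective (left , _) eq = eq
      injective (right , seg) eq = eq
      injective (right , foot) {f} {f′} eq =
        trans (sym (switch-involutive switches f)) (trans (cong (switch switches) eq) (switch-involutive switches f′))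
      injective (right , set) eq = eq

      shoe-fixed : switch switches (footAt zero false) ≡ footAt zero false
      shoe-fixed = trans (cong₂ (λ s b → footAt s (b xor switches s)) (segOf-footAt zero false) (bitOf-footAt zero false))
                         (cong (footAt zero) shoe-unswitched)

      P-preserved : ∀ sd {x y z a b c} →
        get sd foot (ρ x) ≡ just a → get sd foot (ρ y) ≡ just b → get sd foot (ρ z) ≡ just c →
        P (sel untwisted twisted sd)
          (relabel switches (sd , foot) a) (relabel switches (sd , foot) b) (relabel switches (sd , foot) c)
        ≡ P (sel untwisted untwisted sd) a b c
      P-preserved left _ _ _ = refl
      P-preserved right {x} {y} {z} {a} {b} {c} ja jb jc = positive-switch (λ _ → false) (twist r₀) switches a b c
        λ i i-spans → trans (twist-moved i)
          (cong (sum₃ switches (triple i) xor_) (not-twisted-at {i} {a} {b} {c} i-spans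
            (pebbles-off-row x ja , pebbles-off-row y jb , pebbles-off-row z jc)))

    stay : ∀ x v → PebbleOffRow twistNode v → Good (update ρ x v) (update ρ′ x (mapVal (relabel switches) v))
    stay x v v-off = record
      { switches = switches
      ; twistNode = twistNode
      ; relabelled = update-pointwise (λ u u′ → u′ ≡ mapVal (relabel switches) u) x refl relabelled
      ; shoe-unswitched = shoe-unswitched
      ; twist-moved = twist-moved
      ; pebbles-off-row = update-all (PebbleOffRow twistNode) {ρ} x v-off pebbles-off-row
      }

    module FootMove (x : Fin k) where

      pebbleBlock : Fin k → Fin n
      pebbleBlock y = Maybe.maybe′ (blocked twistNode ∘ segOf) zero (get right foot (ρ y))

      blockers : Seg → Fin (ℕ.suc k) → Fin n
      blockers u zero = blocked twistNode u
      blockers u (suc y) = pebbleBlock y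

      -- The new pebble and the k old ones block at most k + 1 of the n = k + 2 row indices.
      escape : Seg → Fin n
      escape u = proj₁ (∃-notInImage (ℕₚ.n<1+n (ℕ.suc k)) (blockers u))

      escape-avoids : ∀ u i → blockers u i ≢ escape u
      escape-avoids u = proj₂ (∃-notInImage (ℕₚ.n<1+n (ℕ.suc k)) (blockers u))

      newSwitches : Seg → Seg → Bool
      newSwitches u s = switches s xor switchOn (pathSwitch twistNode (escape u)) s

      β : Foot → Foot
      β f = switch (newSwitches (segOf f)) f

      β-involutive : ∀ f → β (β f) ≡ f
      β-involutive f = trans (cong (λ s → switch (newSwitches s) (β f)) (segOf-switch (newSwitches (segOf f)) f))
                             (switch-involutive (newSwitches (segOf f)) f)

      module AfterMove (f : Foot) where

        w : Fin n
        w = escape (segOf f)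

        t′ : Seg → Bool
        t′ = newSwitches (segOf f)

        r′ : Node
        r′ = opposite (along twistNode w)

        old-unblocked : ∀ y {f′} → get right foot (ρ y) ≡ just f′ → blocked twistNode (segOf f′) ≢ w
        old-unblocked y f′-pebbled eq =
          escape-avoids (segOf f) (suc y) (trans (cong (Maybe.maybe′ (blocked twistNode ∘ segOf) zero) f′-pebbled) eq)

        old-relabelled : ∀ y → ρ′ y ≡ mapVal (relabel t′) (ρ y)
        old-relabelled y = trans (relabelled y) (relabel-agree (ρ y) λ {f′} f′-pebbled →
          sym (trans (cong (switches (segOf f′) xor_)
                           (pathSwitch-off twistNode w (segOf f′) (pebbles-off-row y f′-pebbled)
                                           (old-unblocked y f′-pebbled)))
                     (xor-identityʳ (switches (segOf f′)))))

        old-off-row : ∀ y → PebbleOffRow r′ (ρ y)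
        old-off-row y {f′} f′-pebbled = off-row-after twistNode w (segOf f′) (old-unblocked y f′-pebbled)

        new-off-row : PebbleOffRow r′ ((right , foot) , f)
        new-off-row refl = off-row-after twistNode w (segOf f) (escape-avoids (segOf f) zero)

        new-twist : ∀ i → twist r₀ i ≡ sum₃ t′ (triple i) xor twist r′ i
        new-twist i = begin
          twist r₀ i
            ≡⟨ twist-moved i ⟩
          sum₃ switches (triple i) xor twist twistNode i
            ≡⟨ solve 3 (λ s t t′ → s :+ t := (s :+ (t :+ t′)) :+ t′) refl
                     (sum₃ switches (triple i)) (twist twistNode i) (twist r′ i) ⟩
          (sum₃ switches (triple i) xor (twist twistNode i xor twist r′ i)) xor twist r′ i
            ≡⟨ cong (λ b → (sum₃ switches (triple i) xor b) xor twist r′ i)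
                    (sym (trans (sum₃-switchOn (pathSwitch twistNode w) (node i))
                                (pathSwitch-boundary twistNode w (node i)))) ⟩
          (sum₃ switches (triple i) xor sum₃ (switchOn (pathSwitch twistNode w)) (triple i)) xor twist r′ i
            ≡⟨ cong (_xor twist r′ i) (sym (sum₃-xor switches (switchOn (pathSwitch twistNode w)) (triple i))) ⟩
          sum₃ t′ (triple i) xor twist r′ i ∎
          where open ≡-Reasoning

      moved : ∀ f → Good (update ρ x ((right , foot) , f)) (update ρ′ x ((right , foot) , β f))
      moved f = record
        { switches = t′
        ; twistNode = r′
        ; relabelled = update-pointwise (λ u u′ → u′ ≡ mapVal (relabel t′) u) x refl old-relabelled
        ; shoe-unswitched = trans (xor-identityʳ (switches zero)) shoe-unswitched
        ; twist-moved = new-twist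
        ; pebbles-off-row = update-all (PebbleOffRow r′) {ρ} x new-off-row old-off-row
        }
        where open AfterMove f

    respond : ∀ x s → Σ (Carrier untwisted untwisted s ↔ Carrier untwisted twisted s) λ β →
              ∀ c → Good (update ρ x (s , c)) (update ρ′ x (s , Inverse.to β c))
    respond x (left , κ) = ↔-id _ , λ c → stay x ((left , κ) , c) (λ ())
    respond x (right , seg) = ↔-id _ , λ c → stay x ((right , seg) , c) (λ ())
    respond x (right , set) = ↔-id _ , λ c → stay x ((right , set) , c) (λ ())
    respond x (right , foot) = mk↔ₛ′ β β β-involutive β-involutive , moved
      where open FootMove x

  start : Good (λ _ → (left , seg) , zero) (λ _ → (left , seg) , zero)
  start = record
    { switches = λ _ → false
    ; twistNode = r₀
    ; relabelled = λ _ → refl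
    ; shoe-unswitched = refl
    ; twist-moved = λ _ → refl
    ; pebbles-off-row = λ _ ()
    }

  open BijectivePebbleGame Good (λ good → atoms-agree (relabel (Good.switches good)) (embedding good) (Good.relabelled good))
                            respond public

mainTheorem6 : ¬ Σ ℕ (λ k → Σ (Form k) (λ φ → DefinesIso φ))
mainTheorem6 (k , φ , defines) = untwisted-≇-twisted (proj₁ (defines untwisted twisted ρ₀) sat-twisted)
  where
  open Game k

  ρ₀ : ∀ {B} → Assignment k untwisted B
  ρ₀ _ = (left , seg) , zero

  sat-untwisted : Sat untwisted untwisted φ ρ₀
  sat-untwisted = proj₂ (defines untwisted untwisted ρ₀) (Iso-refl untwisted)

  sat-twisted : Sat untwisted twisted φ ρ₀
  sat-twisted = Equivalence.to (Sat-agree φ start) sat-untwisted
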